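{- Let $n\geq 1$. Then for every permutation $\sigma\in\mathfrak{S}_{n+1}$ we have $|R_{\bullet}(\sigma)|\leq 4$.
   Context: $\mathfrak{S}_{n+1}$ is the symmetric group on $[n+1]=\{1,\ldots,n+1\}$, with product given by composition of functions read from the right; it is generated by $s_i=(i\ \ i+1)$, $i\in[n]$. A reduced word of $\sigma$ is a word $i_1i_2\cdots i_l$ with letters in $[n]$ such that $\sigma=s_{i_1}s_{i_2}\cdots s_{i_l}$ with $l$ minimal. $R(\sigma)$ is the set of reduced words of $\sigma$. A commutation replaces two consecutive letters $ij$ of a word, with $|i-j|>1$, by $ji$. Two reduced words of $\sigma$ are equivalent if they differ by a sequence of commutations; the equivalence class of $\mathbf{a}\in R(\sigma)$ is its commutation class $[\mathbf{a}]$. $R_{\bullet}(\sigma)$ is the set of one-element commutation classes of $\sigma$, i.e. the set of $\mathbf{a}\in R(\sigma)$ with $[\mathbf{a}]=\{\mathbf{a}\}$ (equivalently, the reduced words of $\sigma$ in which any two consecutive letters differ by exactly $1$). -}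

module Defs where

open import Data.Fin.Base using (Fin; suc; inject₁; toℕ)
open import Data.Fin.Permutation using (Permutation′; _≈_; id; transpose; _∘ₚ_)
open import Data.List.Base using (List; []; _∷_; length)
open import Data.List.Membership.Propositional using (_∈_)
open import Data.List.Relation.Unary.Unique.Propositional using (Unique)
open import Data.Nat.Base using (ℕ; suc; _≤_; _>_; ∣_-_∣)
open import Data.Product.Base using (∃-syntax; _×_)
open import Function.Bundles using (_⇔_)
open import Level using (Level; 0ℓ; _⊔_)
open import Relation.Binary.Construct.Closure.Equivalence using (EqClosure)
open import Relation.Binary.Core using (Rel)
open import Relation.Binary.PropositionalEquality.Core using (_≡_)
open import Relation.Unary using (Pred; ｛_｝; _≐_)

private
  variable
    a ℓ : Level
    n : ℕ

-- The letter i : Fin n stands for toℕ i + 1 ∈ [n], and a point k of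
-- Fin (suc n) for toℕ k + 1 ∈ [n + 1].

Word : ℕ → Set
Word n = List (Fin n)

s : Fin n → Permutation′ (suc n)
s i = transpose (inject₁ i) (suc i)

-- Products are read from the right, whereas π ∘ₚ ρ applies π first; hence
-- s i ∘ eval w is written with the factors reversed.

eval : Word n → Permutation′ (suc n)
eval []      = id
eval (i ∷ w) = eval w ∘ₚ s i

R : Permutation′ (suc n) → Pred (Word n) 0ℓ
R σ w = eval w ≈ σ × (∀ v → eval v ≈ σ → length w ≤ length v)

infix 4 _⇝_

data _⇝_ {n : ℕ} : Rel (Word n) 0ℓ where
  here  : ∀ {i j w} → ∣ toℕ i - toℕ j ∣ > 1 → i ∷ j ∷ w ⇝ j ∷ i ∷ w
  there : ∀ {i w w′} → w ⇝ w′ → i ∷ w ⇝ i ∷ w′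

commutationClass : Permutation′ (suc n) → Word n → Pred (Word n) 0ℓ
commutationClass σ w v = R σ v × EqClosure _⇝_ w v

-- A one-element class is identified with its element.

R• : Permutation′ (suc n) → Pred (Word n) 0ℓ
R• σ w = R σ w × commutationClass σ w ≐ ｛ w ｝

-- Stated by a duplicate-free enumeration rather than a bijection of Fin k
-- with Σ A P, since the latter would also count the proofs of P.

HasCardinality : {A : Set a} → Pred A ℓ → ℕ → Set (a ⊔ ℓ)
HasCardinality P k =
  ∃[ xs ] Unique xs × (∀ x → x ∈ xs ⇔ P x) × length xs ≡ k

{-# OPTIONS --safe #-}
-- In a reduced word all of whose consecutive letters differ by one, a run from l
-- to f that has turned cannot reach f again without first passing beyond l.
-- So, with p and q the extreme letters, the word or its reversal is U (p … q) V,
-- where V and the reversal of U are arms: sequences of runs that spiral inwards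
-- strictly between p and q. The exception is a word that visits p or q twice;
-- it starts or ends at p or at q, its permutation swaps p and q + 1, and it is
-- determined by which of these four cases holds.
--
-- Otherwise the permutation determines the product of the two arms. Since no two
-- strands cross twice, the first run of an arm can be read off this product and
-- removed, again and again, until some strand traverses the whole range common
-- to both arms. That strand may be carried by either arm, and once it is removed
-- one of the two arms is empty; this leaves at most 2 · 2 words.

module Submission where

open import Defs
open import Data.Nat using (ℕ; suc; _≤_; _≥_)
open import Data.Fin.Permutation using (Permutation′)
open import Data.Product using (∃-syntax; _×_)

open import Data.Empty using (⊥; ⊥-elim)
open import Data.Fin.Base as Fin using (Fin; toℕ; fromℕ<; inject₁)
import Data.Fin.Properties as Fin
open import Data.Fin.Induction using (<-weakInduction)
open import Data.Fin.Permutation using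
  (_≈_; transpose; _∘ₚ_; _⟨$⟩ʳ_; lift₀; remove; lift₀-transpose; lift₀-comp; lift₀-remove; lift₀-cong)
open import Data.List.Base using
  (List; []; _∷_; [_]; length; map; _++_; reverse; reverseAcc; filter; deduplicate; cartesianProductWith; allFin)
open import Data.List.Membership.Propositional using (_∈_)
open import Data.List.Membership.Propositional.Properties using
  (∈-filter⁺; ∈-filter⁻; ∈-deduplicate⁺; ∈-deduplicate⁻; ∈-cartesianProductWith⁺; ∈-allFin)
open import Data.List.Properties using
  (++-assoc; ++-identityʳ; length-++; length-map; length-reverse; map-++; map-injective; reverse-++;
   reverse-injective; reverse-involutive; reverse-map; unfold-reverse; ∷-injectiveˡ; ∷-injectiveʳ; ≡-dec)
open import Data.List.Relation.Unary.All as All using (All; []; _∷_)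
import Data.List.Relation.Unary.All.Properties as All
open import Data.List.Relation.Unary.AllPairs using ([]; _∷_)
open import Data.List.Relation.Unary.Any using (here; there)
import Data.List.Relation.Unary.Any.Properties as Any
open import Data.List.Relation.Unary.Linked as Linked using (Linked; []; [-]; _∷_)
open import Data.List.Relation.Unary.Unique.Propositional using (Unique)
import Data.List.Relation.Unary.Unique.DecPropositional.Properties as DecUnique
import Data.List.Relation.Unary.Unique.Propositional.Properties as Unique
open import Data.Nat.Base using (zero; pred; _+_; _∸_; _<_; _>_; ∣_-_∣; z≤n; s≤s)
open import Data.Nat.Properties
open import Data.Product.Base using (_,_; proj₁; proj₂)
open import Data.Sum.Base using (_⊎_; inj₁; inj₂)
open import Data.Unit.Base using (⊤; tt)
open import Function.Base using (id; _∘_)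
open import Function.Bundles using (mk⇔)
open import Level using (Level; 0ℓ)
open import Relation.Binary.Construct.Closure.Equivalence using (EqClosure)
open import Relation.Binary.Construct.Closure.ReflexiveTransitive using (ε; _◅_)
open import Relation.Binary.Construct.Closure.Symmetric using (fwd; bwd)
open import Relation.Binary.Definitions using (tri<; tri≈; tri>)
open import Relation.Binary.PropositionalEquality hiding ([_])
open import Relation.Nullary using (Dec; yes; no; ¬_; contradiction)
open import Relation.Nullary.Decidable using (map′; _×-dec_; _→-dec_)
open import Relation.Unary using (Pred)

-- The bounds for the three shapes of words are never added, because the permutation already knows
-- the shape. It fixes everything below `p` and above `q + 1`, which pins down `p` and `q`. It sends
-- `q + 1` to `p` if the middle ascends, `p` to `q + 1` if the middle descends, and does both if an
-- extreme letter is visited twice.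
--
-- Reading off a run works as long as the other arm leaves the strand that it carries alone. The
-- obstacle is a strand that crosses the whole common range, since its effect does not reveal which
-- arm carries it. This is the only place where a choice remains, and no recursion follows it: all
-- other steps remove the same runs from every solution. Hence the factor four does not multiply
-- along the recursion.

private
  variable
    a ℓ ℓ₁ ℓ₂ : Level
    X Y : Set a
    x y z i j l b lo hi n : ℕ
    A B A′ B′ u v w : List ℕ

-- Bounds on the number of elements of a predicate

AtMost : ℕ → Pred X ℓ → Set _
AtMost k P = ∀ xs → Unique xs → All P xs → length xs ≤ k

module _ {P : Pred X ℓ} where

  -- The bound is trivial for an empty list, so a member may be fixed beforehand. The counting
  -- proofs read off from it what all members share.
  atMost-sample : ∀ {k} → (∀ x → P x → AtMost k P) → AtMost k P
  atMost-sample f []       _ _           = z≤n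
  atMost-sample f (x ∷ xs) u ps@(px ∷ _) = f x px (x ∷ xs) u ps

  atMost-1 : (∀ x y → P x → P y → x ≡ y) → AtMost 1 P
  atMost-1 f []           _                _             = z≤n
  atMost-1 f (x ∷ [])     _                _             = s≤s z≤n
  atMost-1 f (x ∷ y ∷ xs) ((x≢y ∷ _) ∷ _) (px ∷ py ∷ _) = contradiction (f x y px py) x≢y

  atMost-mono : ∀ {k m} → k ≤ m → AtMost k P → AtMost m P
  atMost-mono k≤m f xs u ps = ≤-trans (f xs u ps) k≤m

  -- Injectivity of `f` is not at issue: distinct elements have distinct preimages, so a
  -- duplicate-free list pulls back to a duplicate-free list.
  atMost-image : {Q : Pred Y ℓ₁} {k : ℕ} (f : Y → X) →
                 (∀ x → P x → ∃[ y ] Q y × x ≡ f y) → AtMost k Q → AtMost k P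
  atMost-image {Q = Q} {k} f g most xs u ps with preimages xs ps
    where
    preimages : ∀ xs → All P xs → ∃[ ys ] All Q ys × xs ≡ map f ys
    preimages []       []       = [] , [] , refl
    preimages (x ∷ xs) (p ∷ ps) with g x p | preimages xs ps
    ... | y , q , refl | ys , qs , refl = y ∷ ys , q ∷ qs , refl
  ... | ys , qs , refl = subst (_≤ k) (sym (length-map f ys)) (most ys (Unique.map⁻ u) qs)

  atMost-∪ : {Q₁ : Pred X ℓ₁} {Q₂ : Pred X ℓ₂} {k₁ k₂ : ℕ} → (∀ x → P x → Q₁ x ⊎ Q₂ x) →
             AtMost k₁ Q₁ → AtMost k₂ Q₂ → AtMost (k₁ + k₂) P
  atMost-∪ {Q₁ = Q₁} {Q₂} cover m₁ m₂ xs u ps with split xs u ps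
    where
    split : ∀ xs → Unique xs → All P xs →
            ∃[ ys ] ∃[ zs ] Unique ys × Unique zs × All Q₁ ys × All Q₂ zs ×
            length xs ≡ length ys + length zs ×
            (∀ x → All (x ≢_) xs → All (x ≢_) ys × All (x ≢_) zs)
    split []       _       _        = [] , [] , [] , [] , [] , [] , refl , λ _ _ → [] , []
    split (x ∷ xs) (n ∷ u) (p ∷ ps)
      with split xs u ps
    ... | ys , zs , uy , uz , qy , qz , len , sub with cover x p
    ...   | inj₁ q = x ∷ ys , zs , proj₁ (sub x n) ∷ uy , uz , q ∷ qy , qz , cong suc len ,
                     λ { z (m ∷ ms) → m ∷ proj₁ (sub z ms) , proj₂ (sub z ms) }
    ...   | inj₂ q = ys , x ∷ zs , uy , proj₂ (sub x n) ∷ uz , qy , q ∷ qz ,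
                     trans (cong suc len) (sym (+-suc (length ys) (length zs))) ,
                     λ { z (m ∷ ms) → proj₁ (sub z ms) , m ∷ proj₂ (sub z ms) }
  ... | ys , zs , uy , uz , qy , qz , len , _ =
    subst (_≤ _) (sym len) (+-mono-≤ (m₁ ys uy qy) (m₂ zs uz qz))

-- Cycles carrying one position to another

-- `out x` closes the gap left by removing position `x`, and `ins y` opens a gap at `y`. Away from
-- `x`, a cycle from `x` to `y` is the monotone map `ins y ∘ out x`.
out : ℕ → ℕ → ℕ
out x z with x <? z
... | yes _ = pred z
... | no  _ = z

ins : ℕ → ℕ → ℕ
ins y z with z <? y
... | yes _ = z
... | no  _ = suc z

out-> : x < z → out x z ≡ pred z
out-> {x} {z} x<z with x <? z
... | yes _ = refl
... | no ¬p = contradiction x<z ¬p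

out-≤ : z ≤ x → out x z ≡ z
out-≤ {z} {x} z≤x with x <? z
... | yes p = contradiction p (≤⇒≯ z≤x)
... | no _  = refl

ins-< : z < y → ins y z ≡ z
ins-< {z} {y} z<y with z <? y
... | yes _ = refl
... | no ¬p = contradiction z<y ¬p

ins-≥ : y ≤ z → ins y z ≡ suc z
ins-≥ {y} {z} y≤z with z <? y
... | yes p = contradiction p (≤⇒≯ y≤z)
... | no _  = refl

out-mono-< : ∀ x {a b} → a < b → a ≢ x → b ≢ x → out x a < out x b
out-mono-< x {a} {suc b} a<b a≢x b≢x with <-cmp a x | <-cmp (suc b) x
... | tri≈ _ a≡x _ | _            = contradiction a≡x a≢x
... | _            | tri≈ _ b≡x _ = contradiction b≡x b≢x
... | tri< a<x _ _ | tri< b<x _ _ = subst₂ _<_ (sym (out-≤ (<⇒≤ a<x))) (sym (out-≤ (<⇒≤ b<x))) a<b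
... | tri< a<x _ _ | tri> _ _ x<b = subst₂ _<_ (sym (out-≤ (<⇒≤ a<x))) (sym (out-> x<b)) (≤-trans a<x (≤-pred x<b))
... | tri> _ _ x<a | tri< b<x _ _ = contradiction (<-trans x<a a<b) (<⇒≯ b<x)
out-mono-< x {suc a} {suc b} (s≤s a<b) a≢x b≢x | tri> _ _ x<a | tri> _ _ x<b =
  subst₂ _<_ (sym (out-> x<a)) (sym (out-> x<b)) a<b

ins-mono-< : ∀ y {a b} → a < b → ins y a < ins y b
ins-mono-< y {a} {b} a<b with a <? y | b <? y
... | yes _   | yes _   = a<b
... | yes _   | no _    = m<n⇒m<1+n a<b
... | no a≮y  | yes b<y = contradiction (<-trans a<b b<y) a≮y
... | no _    | no _    = s≤s a<b

ins-≢ : ∀ y z → ins y z ≢ y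
ins-≢ y z with z <? y
... | yes z<y = <⇒≢ z<y
... | no  z≮y = λ { refl → z≮y ≤-refl }

out-ins : ∀ y z → out y (ins y z) ≡ z
out-ins y z with z <? y
... | yes z<y = out-≤ (<⇒≤ z<y)
... | no  z≮y = out-> (s≤s (≮⇒≥ z≮y))

ins-out : ∀ x z → z ≢ x → ins x (out x z) ≡ z
ins-out x z z≢x with <-cmp z x
... | tri< z<x _ _ = trans (cong (ins x) (out-≤ (<⇒≤ z<x))) (ins-< z<x)
... | tri≈ _ z≡x _ = contradiction z≡x z≢x
ins-out x (suc z) z≢x | tri> _ _ x<z = trans (cong (ins x) (out-> x<z)) (ins-≥ (≤-pred x<z))

-- The cycle that carries x to y and moves everything in between one step
-- towards x: the value of a monotone run of letters.

abstract

  jump : ℕ → ℕ → ℕ → ℕ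
  jump x y z with z ≟ x
  ... | yes _ = y
  ... | no  _ = ins y (out x z)

  jump-at : ∀ x y → jump x y x ≡ y
  jump-at x y with x ≟ x
  ... | yes _  = refl
  ... | no x≢x = contradiction refl x≢x

  jump-off : ∀ x y → z ≢ x → jump x y z ≡ ins y (out x z)
  jump-off {z} x y z≢x with z ≟ x
  ... | yes z≡x = contradiction z≡x z≢x
  ... | no _    = refl

  jump-inverse : ∀ x y z → jump y x (jump x y z) ≡ z
  jump-inverse x y z with z ≟ x
  ... | yes refl = jump-at y z
  ... | no z≢x   = begin
    jump y x (ins y (out x z))      ≡⟨ jump-off y x (ins-≢ y (out x z)) ⟩
    ins x (out y (ins y (out x z))) ≡⟨ cong (ins x) (out-ins y (out x z)) ⟩
    ins x (out x z)                 ≡⟨ ins-out x z z≢x ⟩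
    z                               ∎
    where open ≡-Reasoning

jump-mono-< : ∀ x y {a b} → a < b → a ≢ x → b ≢ x → jump x y a < jump x y b
jump-mono-< x y a<b a≢x b≢x =
  subst₂ _<_ (sym (jump-off x y a≢x)) (sym (jump-off x y b≢x))
    (ins-mono-< y (out-mono-< x a<b a≢x b≢x))

jump-injective : ∀ x y {u v} → jump x y u ≡ jump x y v → u ≡ v
jump-injective x y {u} {v} eq =
  trans (sym (jump-inverse x y u)) (trans (cong (jump y x) eq) (jump-inverse x y v))

jump-< : z < x → z < y → jump x y z ≡ z
jump-< {z} {x} {y} z<x z<y =
  trans (jump-off x y (<⇒≢ z<x)) (trans (cong (ins y) (out-≤ (<⇒≤ z<x))) (ins-< z<y))

jump-> : x < z → y < z → jump x y z ≡ z
jump-> {x} {suc z} {y} x<z y<z =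
  trans (jump-off x y (>⇒≢ x<z)) (trans (cong (ins y) (out-> x<z)) (ins-≥ (≤-pred y<z)))

jump-up : x ≤ z → z < y → jump x y (suc z) ≡ z
jump-up {x} {z} {y} x≤z z<y =
  trans (jump-off x y (>⇒≢ (s≤s x≤z))) (trans (cong (ins y) (out-> (s≤s x≤z))) (ins-< z<y))

jump-down : y ≤ z → z < x → jump x y z ≡ suc z
jump-down {y} {z} {x} y≤z z<x =
  trans (jump-off x y (<⇒≢ z<x)) (trans (cong (ins y) (out-≤ (<⇒≤ z<x))) (ins-≥ y≤z))

-- Arms

Injective : (ℕ → ℕ) → Set
Injective f = ∀ {u v} → f u ≡ f v → u ≡ v

module _ {f : ℕ → ℕ} (inj : Injective f) where

  -- Each value below `lo` is already taken by its own fixed point.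
  fixes-≥ : ∀ {lo} → (∀ {x} → x < lo → f x ≡ x) → ∀ {x} → lo ≤ x → lo ≤ f x
  fixes-≥ fix {x} lo≤x = ≮⇒≥ λ fx<lo → <⇒≱ fx<lo (subst (_ ≤_) (sym (inj (fix fx<lo))) lo≤x)

  fixes-≤ : ∀ {hi} → (∀ {x} → hi < x → f x ≡ x) → ∀ {x} → x ≤ hi → f x ≤ hi
  fixes-≤ fix {x} x≤hi = ≮⇒≥ λ hi<fx → <⇒≱ hi<fx (subst (_≤ _) (sym (inj (fix hi<fx))) x≤hi)

-- An arm is coded by the positions to which its runs jump, widest run first;
-- lo and hi bound the positions that are still to be moved.

mutual
  Down : ℕ → ℕ → List ℕ → Set
  Down lo hi []      = ⊤
  -- The starting position belongs to the strand that this run carries, and no later run moves that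
  -- strand: hence `pred hi` here and `suc lo` in `Up`.
  Down lo hi (e ∷ A) = lo ≤ e × e < hi × Up e (pred hi) A

  Up : ℕ → ℕ → List ℕ → Set
  Up lo hi []      = ⊤
  Up lo hi (f ∷ A) = lo < f × f ≤ hi × Down (suc lo) f A

-- Each jump starts where the previous one in the list ends, although the last one is applied first.
-- That this is the product of the letters of an arm is `ev-wDown` and `ev-wUp`.
jumps : ℕ → List ℕ → ℕ → ℕ
jumps x []      = id
jumps x (y ∷ A) = jump x y ∘ jumps y A

jumps⁻¹ : ℕ → List ℕ → ℕ → ℕ
jumps⁻¹ x []      = id
jumps⁻¹ x (y ∷ A) = jumps⁻¹ y A ∘ jump y x

jumps-inverse : ∀ x A z → jumps x A (jumps⁻¹ x A z) ≡ z
jumps-inverse x []      z = refl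
jumps-inverse x (y ∷ A) z =
  trans (cong (jump x y) (jumps-inverse y A (jump y x z))) (jump-inverse y x z)

jumps-injective : ∀ x A → Injective (jumps x A)
jumps-injective x []      eq = eq
jumps-injective x (y ∷ A) eq = jumps-injective y A (jump-injective x y eq)

first : ℕ → List ℕ → ℕ
first x []      = x
first x (y ∷ _) = y

pred-< : x < y → pred y < y
pred-< {y = suc y} _ = ≤-refl

mutual
  Down-fixes-< : ∀ A → Down lo hi A → x < lo → jumps hi A x ≡ x
  Down-fixes-< []      _                 _    = refl
  Down-fixes-< (e ∷ A) (lo≤e , e<hi , u) x<lo =
    trans (cong (jump _ e) (Up-fixes-< A u x<e)) (jump-< (<-trans x<e e<hi) x<e)
    where x<e = <-≤-trans x<lo lo≤e

  Up-fixes-< : ∀ A → Up lo hi A → x < lo → jumps lo A x ≡ x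
  Up-fixes-< []      _                 _    = refl
  Up-fixes-< (f ∷ A) (lo<f , f≤hi , v) x<lo =
    trans (cong (jump _ f) (Down-fixes-< A v (m<n⇒m<1+n x<lo)))
          (jump-< x<lo (<-trans x<lo lo<f))

mutual
  Down-fixes-> : ∀ A → Down lo hi A → hi < x → jumps hi A x ≡ x
  Down-fixes-> []      _                 _    = refl
  Down-fixes-> (e ∷ A) (lo≤e , e<hi , u) hi<x =
    trans (cong (jump _ e) (Up-fixes-> A u (<-trans (pred-< e<hi) hi<x)))
          (jump-> hi<x (<-trans e<hi hi<x))

  Up-fixes-> : ∀ A → Up lo hi A → hi < x → jumps lo A x ≡ x
  Up-fixes-> []      _                 _    = refl
  Up-fixes-> (f ∷ A) (lo<f , f≤hi , v) hi<x =
    trans (cong (jump _ f) (Down-fixes-> A v f<x)) (jump-> (<-trans lo<f f<x) f<x)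
    where f<x = ≤-<-trans f≤hi hi<x

Down-shrink : ∀ A → Down lo hi A → x ≤ first hi A → Down x hi A
Down-shrink []      _              _   = tt
Down-shrink (e ∷ A) (_ , e<hi , u) x≤e = x≤e , e<hi , u

Up-shrink : ∀ A → Up lo hi A → first lo A ≤ x → Up lo x A
Up-shrink []      _              _   = tt
Up-shrink (f ∷ A) (lo<f , _ , v) f≤x = lo<f , f≤x , v

Down-at : ∀ A → Down lo hi A → jumps hi A hi ≡ first hi A
Down-at         []      _              = refl
Down-at {hi = hi} (e ∷ A) (_ , e<hi , u) =
  trans (cong (jump hi e) (Up-fixes-> A u (pred-< e<hi))) (jump-at hi e)

Up-at : ∀ A → Up lo hi A → jumps lo A lo ≡ first lo A
Up-at           []      _             = refl
Up-at {lo = lo} (f ∷ A) (lo<f , _ , v) =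
  trans (cong (jump lo f) (Down-fixes-< A v ≤-refl)) (jump-at lo f)

Down-fixes-first : ∀ A → Down lo hi A → x < first hi A → jumps hi A x ≡ x
Down-fixes-first A v = Down-fixes-< A (Down-shrink A v ≤-refl)

Up-fixes-first : ∀ A → Up lo hi A → first lo A < x → jumps lo A x ≡ x
Up-fixes-first A u = Up-fixes-> A (Up-shrink A u ≤-refl)

-- Strand `hi` takes the lowest position that the arm moves at all, so it crosses every strand
-- between.
Down-inverts : ∀ A → Down lo hi A → first hi A ≤ x → x < hi → jumps hi A hi < jumps hi A x
Down-inverts {hi = hi} {x = x} A v e≤x x<hi = subst (_< jumps hi A x) (sym (Down-at A v))
  (≤∧≢⇒< (fixes-≥ (jumps-injective hi A) (Down-fixes-first A v) e≤x)
    λ eq → <⇒≢ x<hi (jumps-injective hi A (trans (sym eq) (sym (Down-at A v)))))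

Up-inverts : ∀ A → Up lo hi A → lo < x → x ≤ first lo A → jumps lo A x < jumps lo A lo
Up-inverts {lo = lo} {x = x} A u lo<x x≤f = subst (jumps lo A x <_) (sym (Up-at A u))
  (≤∧≢⇒< (fixes-≤ (jumps-injective lo A) (Up-fixes-first A u) x≤f)
    λ eq → >⇒≢ lo<x (jumps-injective lo A (trans eq (sym (Up-at A u)))))

mutual
  -- The image of `hi` is the end of the first run; equal first runs cancel because `jump` is
  -- injective.
  Down-unique : ∀ A B → Down lo hi A → Down b hi B → (∀ x → jumps hi A x ≡ jumps hi B x) → A ≡ B
  Down-unique {hi = hi} A B v w eq =
    Down-unique′ A B v w eq (trans (sym (Down-at A v)) (trans (eq hi) (Down-at B w)))

  Down-unique′ : ∀ A B → Down lo hi A → Down b hi B → (∀ x → jumps hi A x ≡ jumps hi B x) →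
                 first hi A ≡ first hi B → A ≡ B
  Down-unique′ []      []       _             _             _  _    = refl
  Down-unique′ []      (e ∷ B)  _             (_ , e<e , _) _  refl = contradiction e<e (<-irrefl refl)
  Down-unique′ (e ∷ A) []       (_ , e<e , _) _             _  refl = contradiction e<e (<-irrefl refl)
  Down-unique′ (e ∷ A) (.e ∷ B) (_ , _ , u)   (_ , _ , t)   eq refl =
    cong (e ∷_) (Up-unique A B u t (λ x → jump-injective _ e (eq x)))

  Up-unique : ∀ A B → Up lo hi A → Up lo b B → (∀ x → jumps lo A x ≡ jumps lo B x) → A ≡ B
  Up-unique {lo = lo} A B u t eq =
    Up-unique′ A B u t eq (trans (sym (Up-at A u)) (trans (eq lo) (Up-at B t)))

  Up-unique′ : ∀ A B → Up lo hi A → Up lo b B → (∀ x → jumps lo A x ≡ jumps lo B x) →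
               first lo A ≡ first lo B → A ≡ B
  Up-unique′ []      []       _             _             _  _    = refl
  Up-unique′ []      (f ∷ B)  _             (f<f , _)     _  refl = contradiction f<f (<-irrefl refl)
  Up-unique′ (f ∷ A) []       (f<f , _)     _             _  refl = contradiction f<f (<-irrefl refl)
  Up-unique′ (f ∷ A) (.f ∷ B) (_ , _ , v)   (_ , _ , w)   eq refl =
    cong (f ∷_) (Down-unique A B v w (λ x → jump-injective _ f (eq x)))

-- Pairs of arms without double crossings

NoDouble : (ℕ → ℕ) → (ℕ → ℕ) → Set
NoDouble f g = ∀ {x y} → x < y → f y < f x → g y < g x → ⊥

NoDouble-swap : ∀ {f g} → NoDouble f g → NoDouble g f
NoDouble-swap nd x<y p q = nd x<y q p

-- Since `f` is injective and fixes everything from `x` on, `x` occurs in no pair that `f` inverts.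
-- Away from `x` the jump is monotone, so it keeps all inversions of `f`.
NoDouble-strip-> : ∀ x y {f g} → Injective f → (∀ {z} → x ≤ z → f z ≡ z) →
                   NoDouble (jump x y ∘ f) g → NoDouble f g
NoDouble-strip-> x y {f} inj fix nd {u} {v} u<v fv<fu =
  nd u<v (jump-mono-< x y fv<fu (λ e → above v≢x e) (λ e → above u≢x e))
  where
  above : ∀ {w} → w ≢ x → f w ≢ x
  above w≢x e = w≢x (inj (trans e (sym (fix ≤-refl))))
  v≢x : v ≢ x
  v≢x refl = <-asym u<v (subst (v <_) (inj (fix (<⇒≤ v<fu))) v<fu)
    where v<fu = subst (_< f u) (fix ≤-refl) fv<fu
  u≢x : u ≢ x
  u≢x refl = <-asym u<v (subst₂ _<_ (fix (<⇒≤ u<v)) (fix ≤-refl) fv<fu)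

NoDouble-strip-< : ∀ x y {f g} → Injective f → (∀ {z} → z ≤ x → f z ≡ z) →
                   NoDouble (jump x y ∘ f) g → NoDouble f g
NoDouble-strip-< x y {f} inj fix nd {u} {v} u<v fv<fu =
  nd u<v (jump-mono-< x y fv<fu (above v≢x) (above u≢x))
  where
  above : ∀ {w} → w ≢ x → f w ≢ x
  above w≢x e = w≢x (inj (trans e (sym (fix ≤-refl))))
  v≢x : v ≢ x
  v≢x refl = <-asym u<v (subst₂ _<_ (fix ≤-refl) (fix (<⇒≤ u<v)) fv<fu)
  u≢x : u ≢ x
  u≢x refl = <-asym u<v (subst (_< u) (inj (fix (<⇒≤ fv<u))) fv<u)
    where fv<u = subst (f v <_) (fix ≤-refl) fv<fu

≤-pred′ : x < y → x ≤ pred y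
≤-pred′ (s≤s p) = p

-- The two arms of a word meet in its middle, and strands are named by their
-- positions there: jumps b A and jumps d B give their positions at the two ends,
-- which ρ and ρ⁻ relate.

record Solution (l b d h : ℕ) (ρ ρ⁻ : ℕ → ℕ) (AB : List ℕ × List ℕ) : Set where
  constructor sol
  field
    down : Down l b (proj₁ AB)
    up   : Up d h (proj₂ AB)
    to   : ∀ x → ρ (jumps d (proj₂ AB) x) ≡ jumps b (proj₁ AB) x
    from : ∀ x → ρ⁻ (jumps b (proj₁ AB) x) ≡ jumps d (proj₂ AB) x
    nd   : NoDouble (jumps b (proj₁ AB)) (jumps d (proj₂ AB))

open Solution

module _ {l b d h : ℕ} {ρ ρ⁻ : ℕ → ℕ} where

  private S = Solution l b d h ρ ρ⁻

  sol-uniqueʳ : S (A , B) → S (A , B′) → (A , B) ≡ (A , B′)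
  sol-uniqueʳ s t = cong (_ ,_) (Up-unique _ _ (up s) (up t)
    λ x → trans (sym (from s x)) (from t x))

  sol-uniqueˡ : S (A , B) → S (A′ , B) → (A , B) ≡ (A′ , B)
  sol-uniqueˡ s t = cong (_, _) (Down-unique _ _ (down s) (down t)
    λ x → trans (sym (to s x)) (to t x))

  -- Strands below `b` are fixed by the second arm and strands above `b` by the first, so the first
  -- arms of two solutions agree on every strand but `b`. A bijection is determined by its values
  -- off one point.
  sol-disjoint : b ≤ d → ∀ s t → S s → S t → s ≡ t
  sol-disjoint b≤d (A , B) (A′ , B′) s t = lemma (Down-unique A A′ (down s) (down t) agree)
    where
    lemma : A ≡ A′ → (A , B) ≡ (A′ , B′)
    lemma refl = sol-uniqueʳ s t
    off : ∀ {x} → x ≢ b → jumps b A x ≡ jumps b A′ x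
    off {x} x≢b with <-cmp x b
    ... | tri< x<b _ _ = begin
      jumps b A x         ≡⟨ to s x ⟨
      ρ (jumps d B x)     ≡⟨ cong ρ (Up-fixes-< B (up s) x<d) ⟩
      ρ x                 ≡⟨ cong ρ (Up-fixes-< B′ (up t) x<d) ⟨
      ρ (jumps d B′ x)    ≡⟨ to t x ⟩
      jumps b A′ x        ∎
      where
      open ≡-Reasoning
      x<d = <-≤-trans x<b b≤d
    ... | tri≈ _ x≡b _ = contradiction x≡b x≢b
    ... | tri> _ _ b<x = trans (Down-fixes-> A (down s) b<x) (sym (Down-fixes-> A′ (down t) b<x))
    agree : ∀ x → jumps b A x ≡ jumps b A′ x
    agree x with x ≟ b
    ... | no x≢b   = off x≢b
    -- `z` is the strand that `A′` sends to where `A` sends `b`. Were it not `b`, then `A` would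
    -- send both strands to the same position.
    ... | yes refl with jumps⁻¹ b A′ (jumps b A b) in eq
    ...   | z with z ≟ b
    ...     | yes refl = trans (sym (jumps-inverse b A′ _)) (cong (jumps b A′) eq)
    ...     | no z≢b   = contradiction
      (jumps-injective b A (trans (off z≢b) (trans (cong (jumps b A′) (sym eq)) (jumps-inverse b A′ _)))) z≢b

  module _ (d<b : d < b) where

    -- Otherwise the strands `d` and `b` would cross in both arms.
    first-<b : S (A , B) → first b A ≤ d → first d B < b
    first-<b {A} {B} s e≤d = ≰⇒> λ b≤f →
      nd s d<b (Down-inverts A (down s) e≤d d<b) (Up-inverts B (up s) d<b b≤f)

    d<-first : S (A , B) → b ≤ first d B → d < first b A
    d<-first s b≤f = ≰⇒> λ e≤d → <⇒≱ (first-<b s e≤d) b≤f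

    -- The second arm leaves strand `b` alone, so `ρ` shows where the first arm takes it.
    at-b : S (A , B) → first d B < b → ρ b ≡ first b A
    at-b {A} {B} s f<b = begin
      ρ b              ≡⟨ cong ρ (Up-fixes-first B (up s) f<b) ⟨
      ρ (jumps d B b)  ≡⟨ to s b ⟩
      jumps b A b      ≡⟨ Down-at A (down s) ⟩
      first b A        ∎
      where open ≡-Reasoning

    at-d : S (A , B) → d < first b A → ρ⁻ d ≡ first d B
    at-d {A} {B} s d<e = begin
      ρ⁻ d              ≡⟨ cong ρ⁻ (Down-fixes-first A (down s) d<e) ⟨
      ρ⁻ (jumps b A d)  ≡⟨ from s d ⟩
      jumps d B d       ≡⟨ Up-at B (up s) ⟩
      first d B         ∎
      where open ≡-Reasoning

    -- The position `e` below `d` is the test. If a first run ends there, then `ρ⁻ e` is `b`; if the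
    -- first run of another solution stopped above `d`, neither of its arms would move strand `e`,
    -- and `ρ⁻ e` would be `e`.
    below : S (A , B) → S (A′ , B′) → first b A < d → first b A′ ≡ first b A × first d B′ < b
    below {A} {B} {A′} {B′} s t e<d with first b A′ ≤? d
    ... | yes e′≤d = trans (sym (at-b t f′<b)) (at-b s (first-<b s (<⇒≤ e<d))) , f′<b
      where f′<b = first-<b t e′≤d
    ... | no  e′≰d = contradiction (trans (sym fromˢ) fromᵗ) (>⇒≢ (<-trans e<d d<b))
      where
      e : ℕ
      e = first b A
      fromˢ : ρ⁻ e ≡ b
      fromˢ = trans (cong ρ⁻ (sym (Down-at A (down s))))
        (trans (from s b) (Up-fixes-first B (up s) (first-<b s (<⇒≤ e<d))))
      fromᵗ : ρ⁻ e ≡ e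
      fromᵗ = trans (cong ρ⁻ (sym (Down-fixes-first A′ (down t) (<-trans e<d (≰⇒> e′≰d)))))
        (trans (from t e) (Up-fixes-< B′ (up t) e<d))

    above : S (A , B) → S (A′ , B′) → b < first d B → first d B′ ≡ first d B × d < first b A′
    above {A} {B} {A′} {B′} s t b<f with b ≤? first d B′
    ... | yes b≤f′ = trans (sym (at-d t d<e′)) (at-d s (d<-first s (<⇒≤ b<f))) , d<e′
      where d<e′ = d<-first t b≤f′
    ... | no  b≰f′ = contradiction (trans (sym toˢ) toᵗ) (<⇒≢ (<-trans d<b b<f))
      where
      f : ℕ
      f = first d B
      toˢ : ρ f ≡ d
      toˢ = trans (cong ρ (sym (Up-at B (up s))))
        (trans (to s d) (Down-fixes-first A (down s) (d<-first s (<⇒≤ b<f))))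
      toᵗ : ρ f ≡ f
      toᵗ = trans (cong ρ (sym (Up-fixes-first B′ (up t) (<-trans (≰⇒> b≰f′) b<f))))
        (trans (to t f) (Down-fixes-> A′ (down t) b<f))

    -- Once the run between b and d is removed, two nonempty arms would both
    -- cross the same two adjacent strands.

    crossing : S (A , B) → d ≤ first b A → first d B ≤ b → ρ b ≡ d →
               (A ≡ d ∷ [] ⊎ B ≡ []) ⊎ (B ≡ b ∷ [] ⊎ A ≡ [])
    crossing {A} {B} s d≤e f≤b ρb≡d with m≤n⇒m<n∨m≡n f≤b
    crossing {A} {B} s d≤e f≤b ρb≡d | inj₁ f<b = inj₁ (via-A A B s (trans (sym (at-b s f<b)) ρb≡d))
      where
      via-A : ∀ A B → S (A , B) → first b A ≡ d → A ≡ d ∷ [] ⊎ B ≡ []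
      via-A []      B s b≡d  = contradiction (sym b≡d) (<⇒≢ d<b)
      via-A (_ ∷ A) [] s refl = inj₂ refl
      via-A (_ ∷ []) B s refl = inj₁ refl
      via-A (_ ∷ A@(_ ∷ _)) B@(_ ∷ _) s@(sol (_ , _ , u@(d<x , _)) v@(d<y , _) _ _ _) refl =
        ⊥-elim (NoDouble-strip-> b d (jumps-injective d A) (λ b≤z → Up-fixes-> A u (<-≤-trans (pred-< d<b) b≤z))
          (nd s) ≤-refl (Up-inverts A u ≤-refl d<x) (Up-inverts B v ≤-refl d<y))
    crossing {A} {B} s d≤e f≤b ρb≡d | inj₂ f≡b = inj₂ (via-B A B s f≡b)
      where
      via-B : ∀ A B → S (A , B) → first d B ≡ b → B ≡ b ∷ [] ⊎ A ≡ []
      via-B A []       s d≡b  = contradiction d≡b (<⇒≢ d<b)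
      via-B [] (_ ∷ B) s refl = inj₂ refl
      via-B A (_ ∷ []) s refl = inj₁ refl
      via-B A@(_ ∷ _) (_ ∷ B@(_ ∷ _)) s@(sol v@(_ , x<b , _) (_ , _ , u@(_ , y<b , _)) _ _ _) refl =
        ⊥-elim (NoDouble-strip-< d b (jumps-injective b B) (λ z≤d → Down-fixes-< B u (s≤s z≤d))
          (NoDouble-swap (nd s)) (pred-< d<b)
          (Down-inverts B u (≤-pred′ y<b) (pred-< d<b)) (Down-inverts A v (≤-pred′ x<b) (pred-< d<b)))

    -- An arm whose first run ends exactly at the far end of the common range takes its strand there
    -- while the other arm leaves it alone. Whichever arm it is, `ρ b ≡ d` results.
    uncrossed : S (A , B) → d ≤ first b A → first d B ≤ b → ρ b ≢ d →
                d < first b A × first d B < b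
    uncrossed {A} {B} s d≤e f≤b ρb≢d with m≤n⇒m<n∨m≡n d≤e | m≤n⇒m<n∨m≡n f≤b
    ... | inj₁ d<e | inj₁ f<b = d<e , f<b
    ... | inj₂ d≡e | _        = contradiction (trans (at-b s (first-<b s (≤-reflexive (sym d≡e)))) (sym d≡e)) ρb≢d
    ... | inj₁ d<e | inj₂ f≡b = contradiction
      (trans (cong ρ (sym (trans (Up-at B (up s)) f≡b))) (trans (to s d) (Down-fixes-first A (down s) d<e))) ρb≢d


Down-first⁻ : ∀ A → Down lo hi A → first hi A ≡ hi → A ≡ []
Down-first⁻ []      _             _    = refl
Down-first⁻ (_ ∷ _) (_ , e<e , _) refl = contradiction e<e (<-irrefl refl)

Up-first⁻ : ∀ A → Up lo hi A → first lo A ≡ lo → A ≡ []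
Up-first⁻ []      _         _    = refl
Up-first⁻ (_ ∷ _) (f<f , _) refl = contradiction f<f (<-irrefl refl)

first-∷ : ∀ A → first x A ≡ y → y ≢ x → ∃[ A′ ] A ≡ y ∷ A′
first-∷ []      refl y≢x = contradiction refl y≢x
first-∷ (_ ∷ A) refl _   = A , refl

-- The four bounds are independent because removing runs destroys the initial symmetry `l ≡ d`,
-- `b ≡ h`. Every removal lowers `b + h`, which `n` bounds, and maps all solutions to those of a
-- single smaller problem.
atMost-4 : ∀ n {l b d h ρ ρ⁻} → b + h < n → l ≤ d → b ≤ h → AtMost 4 (Solution l b d h ρ ρ⁻)
atMost-4 (suc n) {l} {b} {d} {h} {ρ} {ρ⁻} (s≤s b+h≤n) l≤d b≤h with d <? b
... | no d≮b = atMost-mono (s≤s z≤n) (atMost-1 (sol-disjoint (≮⇒≥ d≮b)))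
... | yes d<b = atMost-sample {P = S} λ (A₀ , B₀) s₀ → step A₀ B₀ s₀
  where
  S = Solution l b d h ρ ρ⁻

  -- By `below`, every solution has the first run `e`. The second run is determined as well, since
  -- the second arm fixes strand `e` and `ρ e` therefore shows its end. Removing both leaves a
  -- downward arm again.
  low : ∀ e A₀ B₀ → S (e ∷ A₀ , B₀) → e < d → AtMost 4 S
  low e A₀ B₀ s₀ e<d = cases A₀ s₀ shape
    where
    second : ∀ {A B} → S (e ∷ A , B) → jump b e (first e A) ≡ ρ e
    second {A} {B} t = trans (cong (jump b e) (sym (Up-at A (proj₂ (proj₂ (down t))))))
      (trans (sym (to t e)) (cong ρ (Up-fixes-< B (up t) e<d)))

    shape : ∀ {A B} → S (A , B) → ∃[ A′ ] A ≡ e ∷ A′ × first e A′ ≡ first e A₀ × first d B < b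
    shape {A} {B} t with below d<b s₀ t e<d
    ... | eq , f<b with first-∷ A eq (<⇒≢ (<-trans e<d d<b))
    ...   | A′ , refl = A′ , refl , jump-injective b e (trans (second t) (sym (second s₀))) , f<b

    cases : ∀ A₀ → S (e ∷ A₀ , B₀) →
            (∀ {A B} → S (A , B) → ∃[ A′ ] A ≡ e ∷ A′ × first e A′ ≡ first e A₀ × first d B < b) →
            AtMost 4 S
    cases [] _ shape = atMost-mono (s≤s z≤n) (atMost-1 unique)
      where
      unique : ∀ s t → S s → S t → s ≡ t
      unique _ _ s t with shape s | shape t
      ... | A , refl , eq , _ | A′ , refl , eq′ , _
        with Up-first⁻ A (proj₂ (proj₂ (down s))) eq | Up-first⁻ A′ (proj₂ (proj₂ (down t))) eq′
      ... | refl | refl = sol-uniqueʳ s t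
    cases (f ∷ A₁) s₀ shape = atMost-image (λ (A , B) → e ∷ f ∷ A , B) strip
      (atMost-4 n {ρ = jump f e ∘ jump e b ∘ ρ} {ρ⁻ = ρ⁻ ∘ jump b e ∘ jump e f}
        (<-≤-trans (+-mono-<-≤ (≤-<-trans f≤b′ (pred-< d<b)) (≤-trans pred[n]≤n b≤h)) b+h≤n) e<d f≤b′)
      where
      e<f : e < f
      e<f = proj₁ (proj₂ (proj₂ (down s₀)))
      f≤b′ : f ≤ pred b
      f≤b′ = proj₁ (proj₂ (proj₂ (proj₂ (down s₀))))
      strip : ∀ s → S s → ∃[ (A , B) ] Solution (suc e) f d (pred b) (jump f e ∘ jump e b ∘ ρ)
                (ρ⁻ ∘ jump b e ∘ jump e f) (A , B) × s ≡ (e ∷ f ∷ A , B)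
      strip (_ , B) s with shape s
      ... | A′ , refl , eq , fB<b with first-∷ A′ eq (>⇒≢ e<f)
      ...   | A , refl = (A , B) , record
        { down = arm
        ; up   = Up-shrink B (up s) (≤-pred′ fB<b)
        ; to   = λ x → trans (cong (jump f e ∘ jump e b) (to s x))
                   (trans (cong (jump f e) (jump-inverse b e _)) (jump-inverse e f _))
        ; from = from s
        ; nd   = NoDouble-strip-< e f (jumps-injective f A) (λ z≤e → Down-fixes-< A arm (s≤s z≤e))
                   (NoDouble-strip-> b e (jumps-injective e (f ∷ A))
                     (λ b≤z → Up-fixes-> (f ∷ A) (proj₂ (proj₂ (down s))) (<-≤-trans (pred-< d<b) b≤z)) (nd s))
        } , refl
        where arm = proj₂ (proj₂ (proj₂ (proj₂ (down s))))

  high : ∀ f A₀ B₀ → S (A₀ , f ∷ B₀) → b < f → AtMost 4 S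
  high f A₀ B₀ s₀ b<f = cases B₀ s₀ shape
    where
    second : ∀ {A B} → S (A , f ∷ B) → jump d f (first f B) ≡ ρ⁻ f
    second {A} {B} t = trans (cong (jump d f) (sym (Down-at B (proj₂ (proj₂ (up t))))))
      (trans (sym (from t f)) (cong ρ⁻ (Down-fixes-> A (down t) b<f)))

    shape : ∀ {A B} → S (A , B) → ∃[ B′ ] B ≡ f ∷ B′ × first f B′ ≡ first f B₀ × d < first b A
    shape {A} {B} t with above d<b s₀ t b<f
    ... | eq , d<e with first-∷ B eq (>⇒≢ (<-trans d<b b<f))
    ...   | B′ , refl = B′ , refl , jump-injective d f (trans (second t) (sym (second s₀))) , d<e

    cases : ∀ B₀ → S (A₀ , f ∷ B₀) →
            (∀ {A B} → S (A , B) → ∃[ B′ ] B ≡ f ∷ B′ × first f B′ ≡ first f B₀ × d < first b A) →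
            AtMost 4 S
    cases [] _ shape = atMost-mono (s≤s z≤n) (atMost-1 unique)
      where
      unique : ∀ s t → S s → S t → s ≡ t
      unique _ _ s t with shape s | shape t
      ... | B , refl , eq , _ | B′ , refl , eq′ , _
        with Down-first⁻ B (proj₂ (proj₂ (up s))) eq | Down-first⁻ B′ (proj₂ (proj₂ (up t))) eq′
      ... | refl | refl = sol-uniqueˡ s t
    cases (e ∷ B₁) s₀ shape = atMost-image (λ (A , B) → A , f ∷ e ∷ B) strip
      (atMost-4 n {ρ = ρ ∘ jump d f ∘ jump f e} {ρ⁻ = jump e f ∘ jump f d ∘ ρ⁻}
        (<-≤-trans (+-monoʳ-< b (<-≤-trans (pred-< b<f) f≤h)) b+h≤n) d<e (≤-pred′ b<f))
      where
      f≤h : f ≤ h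
      f≤h = proj₁ (proj₂ (up s₀))
      d<e : d < e
      d<e = proj₁ (proj₂ (proj₂ (up s₀)))
      e<f : e < f
      e<f = proj₁ (proj₂ (proj₂ (proj₂ (up s₀))))
      strip : ∀ s → S s → ∃[ (A , B) ] Solution (suc d) b e (pred f) (ρ ∘ jump d f ∘ jump f e)
                (jump e f ∘ jump f d ∘ ρ⁻) (A , B) × s ≡ (A , f ∷ e ∷ B)
      strip (A , _) s with shape s
      ... | B′ , refl , eq , d<eA with first-∷ B′ eq (<⇒≢ e<f)
      ...   | B , refl = (A , B) , record
        { down = Down-shrink A (down s) d<eA
        ; up   = arm
        ; to   = to s
        ; from = λ x → trans (cong (jump e f ∘ jump f d) (from s x))
                   (trans (cong (jump e f) (jump-inverse d f _)) (jump-inverse f e _))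
        ; nd   = NoDouble-swap (NoDouble-strip-> f e (jumps-injective e B)
                   (λ f≤z → Up-fixes-> B arm (<-≤-trans (pred-< b<f) f≤z))
                   (NoDouble-strip-< d f (jumps-injective f (e ∷ B))
                     (λ z≤d → Down-fixes-< (e ∷ B) (proj₂ (proj₂ (up s))) (s≤s z≤d)) (NoDouble-swap (nd s))))
        } , refl
        where arm = proj₂ (proj₂ (proj₂ (proj₂ (up s))))

  middle : ∀ A₀ B₀ → S (A₀ , B₀) → (∀ {A B} → S (A , B) → d ≤ first b A × first d B ≤ b) → AtMost 4 S
  middle A₀ B₀ s₀ within with ρ b ≟ d
  -- For each arm that may carry the strand from `b` to `d`, either that arm is this single run or
  -- the other arm is empty. In each of the four cases one arm is known, and `ρ` determines the
  -- other.
  ... | yes ρb≡d = atMost-∪ {k₁ = 2} {k₂ = 2} cover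
      (atMost-∪ {k₁ = 1} {k₂ = 1} (λ { _ (s , inj₁ eq) → inj₁ (s , eq) ; _ (s , inj₂ eq) → inj₂ (s , eq) })
        (fixedˡ (d ∷ [])) (fixedʳ []))
      (atMost-∪ {k₁ = 1} {k₂ = 1} (λ { _ (s , inj₁ eq) → inj₁ (s , eq) ; _ (s , inj₂ eq) → inj₂ (s , eq) })
        (fixedʳ (b ∷ [])) (fixedˡ []))
    where
    cover : ∀ s → S s → (S s × (proj₁ s ≡ d ∷ [] ⊎ proj₂ s ≡ [])) ⊎ (S s × (proj₂ s ≡ b ∷ [] ⊎ proj₁ s ≡ []))
    cover _ s with crossing d<b s (proj₁ (within s)) (proj₂ (within s)) ρb≡d
    ... | inj₁ c = inj₁ (s , c)
    ... | inj₂ c = inj₂ (s , c)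
    fixedˡ : ∀ A → AtMost 1 (λ s → S s × proj₁ s ≡ A)
    fixedˡ A = atMost-1 λ { _ _ (s , refl) (t , refl) → sol-uniqueʳ s t }
    fixedʳ : ∀ B → AtMost 1 (λ s → S s × proj₂ s ≡ B)
    fixedʳ B = atMost-1 λ { _ _ (s , refl) (t , refl) → sol-uniqueˡ s t }
  ... | no ρb≢d = cases A₀ B₀ s₀ shape
    where
    shape : ∀ {A B} → S (A , B) →
            first b A ≡ first b A₀ × first d B ≡ first d B₀
    shape {A} {B} t with uncrossed d<b s₀ (proj₁ (within s₀)) (proj₂ (within s₀)) ρb≢d
                       | uncrossed d<b t (proj₁ (within t)) (proj₂ (within t)) ρb≢d
    ... | d<e₀ , f₀<b | d<e , f<b = trans (sym (at-b d<b t f<b)) (at-b d<b s₀ f₀<b) ,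
                                    trans (sym (at-d d<b t d<e)) (at-d d<b s₀ d<e₀)

    cases : ∀ A₀ B₀ → S (A₀ , B₀) →
            (∀ {A B} → S (A , B) → first b A ≡ first b A₀ × first d B ≡ first d B₀) → AtMost 4 S
    cases [] _ _ shape = atMost-mono (s≤s z≤n) (atMost-1 unique)
      where
      unique : ∀ s t → S s → S t → s ≡ t
      unique (A , _) (A′ , _) s t
        with Down-first⁻ A (down s) (proj₁ (shape s)) | Down-first⁻ A′ (down t) (proj₁ (shape t))
      ... | refl | refl = sol-uniqueʳ s t
    cases (_ ∷ _) [] _ shape = atMost-mono (s≤s z≤n) (atMost-1 unique)
      where
      unique : ∀ s t → S s → S t → s ≡ t
      unique (_ , B) (_ , B′) s t
        with Up-first⁻ B (up s) (proj₂ (shape s)) | Up-first⁻ B′ (up t) (proj₂ (shape t))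
      ... | refl | refl = sol-uniqueˡ s t
    -- Removing the first run of both arms turns a downward arm into an upward
    -- one and conversely, so the two arms change roles.
    cases (e ∷ A₁) (f ∷ B₁) s₀ shape = atMost-image (λ (A , B) → e ∷ B , f ∷ A) strip
      (atMost-4 n {ρ = jump f d ∘ ρ⁻ ∘ jump b e} {ρ⁻ = jump e b ∘ ρ ∘ jump d f}
        (<-≤-trans (+-mono-<-≤ f<b (≤-trans pred[n]≤n b≤h)) b+h≤n) d<e (≤-pred′ f<b))
      where
      bounds = uncrossed d<b s₀ (proj₁ (within s₀)) (proj₂ (within s₀)) ρb≢d
      d<e = proj₁ bounds
      f<b = proj₂ bounds
      strip : ∀ s → S s → ∃[ (A , B) ] Solution (suc d) f e (pred b) (jump f d ∘ ρ⁻ ∘ jump b e)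
                (jump e b ∘ ρ ∘ jump d f) (A , B) × s ≡ (e ∷ B , f ∷ A)
      strip (A , B) s with first-∷ A (proj₁ (shape s)) (<⇒≢ (proj₁ (proj₂ (down s₀))))
                         | first-∷ B (proj₂ (shape s)) (>⇒≢ (proj₁ (up s₀)))
      ... | A′ , refl | B′ , refl = (B′ , A′) , record
        { down = armᵥ
        ; up   = armᵤ
        ; to   = λ x → trans (cong (jump f d) (from s x)) (jump-inverse d f _)
        ; from = λ x → trans (cong (jump e b) (to s x)) (jump-inverse b e _)
        ; nd   = NoDouble-strip-< d f (jumps-injective f B′) (λ z≤d → Down-fixes-< B′ armᵥ (s≤s z≤d))
                   (NoDouble-swap (NoDouble-strip-> b e (jumps-injective e A′)
                     (λ b≤z → Up-fixes-> A′ armᵤ (<-≤-trans (pred-< d<b) b≤z)) (nd s)))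
        } , refl
        where
        armᵤ = proj₂ (proj₂ (down s))
        armᵥ = proj₂ (proj₂ (up s))

  step : ∀ A₀ B₀ → S (A₀ , B₀) → AtMost 4 S
  step A₀ B₀ s₀ with first b A₀ <? d | b <? first d B₀
  step [] B₀ s₀       | yes b<d | _       = contradiction b<d (<-asym d<b)
  step (e ∷ A₀) B₀ s₀ | yes e<d | _       = low e A₀ B₀ s₀ e<d
  step A₀ [] s₀       | no _    | yes b<d = contradiction b<d (<-asym d<b)
  step A₀ (f ∷ B₀) s₀ | no _    | yes b<f = high f A₀ B₀ s₀ b<f
  step A₀ B₀ s₀       | no e≮d  | no b≮f  = middle A₀ B₀ s₀ λ {A} {B} t →
    ≮⇒≥ (λ e<d → e≮d (subst (_< d) (sym (proj₁ (below d<b t s₀ e<d))) e<d)) ,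
    ≮⇒≥ (λ b<f → b≮f (subst (b <_) (sym (proj₁ (above d<b t s₀ b<f))) b<f))

-- Reduced words

All-reverse : ∀ {a p} {X : Set a} {P : Pred X p} {w} → All P w → All P (reverse w)
All-reverse ps = All.tabulate (All.lookup ps ∘ Any.reverse⁻)

sw : ℕ → ℕ → ℕ
sw i = jump i (suc i)

sw-suc : ∀ i → sw i (suc i) ≡ i
sw-suc i = jump-up ≤-refl ≤-refl

sw-off : z ≢ i → z ≢ suc i → sw i z ≡ z
sw-off {z} {i} z≢i z≢1+i with <-cmp z i
... | tri< z<i _ _ = jump-< z<i (m<n⇒m<1+n z<i)
... | tri≈ _ z≡i _ = contradiction z≡i z≢i
... | tri> _ _ i<z = jump-> i<z (≤∧≢⇒< i<z (z≢1+i ∘ sym))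

sw-conj : ∀ {c} → Injective c → c i ≡ j → c (suc i) ≡ suc j → ∀ z → sw j (c z) ≡ c (sw i z)
sw-conj {i} {j} {c} inj ci cj z with z ≟ i | z ≟ suc i
... | yes refl | _        = trans (cong (sw j) ci) (trans (jump-at j (suc j))
                              (trans (sym cj) (cong c (sym (jump-at i (suc i))))))
... | no _     | yes refl = trans (cong (sw j) cj) (trans (sw-suc j) (trans (sym ci) (cong c (sym (sw-suc i)))))
... | no z≢i   | no z≢1+i = trans (sw-off (λ e → z≢i (inj (trans e (sym ci)))) (λ e → z≢1+i (inj (trans e (sym cj)))))
                              (cong c (sym (sw-off z≢i z≢1+i)))

sw-involutive : ∀ i z → sw i (sw i z) ≡ z
sw-involutive i z with z ≟ i | z ≟ suc i
... | yes refl | _        = trans (cong (sw i) (jump-at i (suc i))) (sw-suc i)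
... | no _     | yes refl = trans (cong (sw i) (sw-suc i)) (jump-at i (suc i))
... | no z≢i   | no z≢1+i = trans (cong (sw i) (sw-off z≢i z≢1+i)) (sw-off z≢i z≢1+i)

sw-inverts : ∀ {a b} → a < b → sw i b < sw i a → a ≡ i × b ≡ suc i
sw-inverts {i} {a} {b} a<b p with a ≟ i | b ≟ suc i
... | yes refl | yes refl = refl , refl
... | yes refl | no b≢1+i = contradiction
  (subst₂ _<_ (sw-off (>⇒≢ a<b) b≢1+i) (jump-at i (suc i)) p) (≤⇒≯ a<b)
... | no a≢i   | _ with b ≟ i
...   | no b≢i   = contradiction p (<-asym (jump-mono-< i (suc i) a<b a≢i b≢i))
...   | yes refl = contradiction (subst₂ _<_ (jump-at i (suc i)) (jump-< a<b (m<n⇒m<1+n a<b)) p)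
                     (<-asym (m<n⇒m<1+n a<b))

ev : List ℕ → ℕ → ℕ
ev []      = id
ev (i ∷ w) = sw i ∘ ev w

ev-++ : ∀ u v x → ev (u ++ v) x ≡ ev u (ev v x)
ev-++ []      v x = refl
ev-++ (i ∷ u) v x = cong (sw i) (ev-++ u v x)

ev-injective : ∀ w → Injective (ev w)
ev-injective []      eq = eq
ev-injective (i ∷ w) eq = ev-injective w (jump-injective i (suc i) eq)

ev-reverse : ∀ w x → ev (reverse w) (ev w x) ≡ x
ev-reverse []      x = refl
ev-reverse (i ∷ w) x = begin
  ev (reverse (i ∷ w)) (sw i (ev w x))      ≡⟨ cong (λ v → ev v (sw i (ev w x))) (unfold-reverse i w) ⟩
  ev (reverse w ++ [ i ]) (sw i (ev w x))   ≡⟨ ev-++ (reverse w) [ i ] _ ⟩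
  ev (reverse w) (sw i (sw i (ev w x)))     ≡⟨ cong (ev (reverse w)) (sw-involutive i _) ⟩
  ev (reverse w) (ev w x)                   ≡⟨ ev-reverse w x ⟩
  x                                         ∎
  where open ≡-Reasoning

ev-reverseʳ : ∀ w x → ev w (ev (reverse w) x) ≡ x
ev-reverseʳ w x = trans (cong (λ v → ev v (ev (reverse w) x)) (sym (reverse-involutive w))) (ev-reverse (reverse w) x)

ev-fixes-< : All (x <_) w → ev w x ≡ x
ev-fixes-< []       = refl
ev-fixes-< {x} {i ∷ w} (p ∷ ps) = trans (cong (sw i) (ev-fixes-< ps)) (jump-< p (m<n⇒m<1+n p))

ev-fixes-> : All (λ i → suc i < x) w → ev w x ≡ x
ev-fixes-> []       = refl
ev-fixes-> {x} {i ∷ w} (p ∷ ps) = trans (cong (sw i) (ev-fixes-> ps)) (jump-> (<-trans (n<1+n i) p) p)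

-- Carries a word past the permutation `c`, whose effect on the letters is the renaming `f`.
ev-conj : ∀ {c f} {R : Pred ℕ 0ℓ} → Injective c → (∀ {i} → R i → c i ≡ f i × c (suc i) ≡ suc (f i)) →
          All R w → ∀ z → ev (map f w) (c z) ≡ c (ev w z)
ev-conj inj H []       z = refl
ev-conj {w = i ∷ w} {c} {f} inj H (p ∷ ps) z =
  trans (cong (sw (f i)) (ev-conj inj H ps z)) (sw-conj inj (proj₁ (H p)) (proj₂ (H p)) _)

module _ (w : List ℕ) where

  ev-≥ : All (lo ≤_) w → lo ≤ x → lo ≤ ev w x
  ev-≥ ps = fixes-≥ (ev-injective w) (λ x<lo → ev-fixes-< (All.map (<-≤-trans x<lo) ps))

  ev-≤ : All (_< hi) w → x ≤ hi → ev w x ≤ hi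
  ev-≤ ps = fixes-≤ (ev-injective w) (λ hi<x → ev-fixes-> (All.map (λ i<hi → ≤-<-trans i<hi hi<x) ps))

Exchanged : ℕ → ℕ → (ℕ → ℕ) → (ℕ → ℕ) → Set
Exchanged x y f g = g x ≡ f y × g y ≡ f x × (∀ {z} → z ≢ x → z ≢ y → g z ≡ f z)

module Reduced (L : Pred ℕ 0ℓ) where

  Red : List ℕ → Set
  Red w = All L w × (∀ v → All L v → (∀ x → ev v x ≡ ev w x) → length w ≤ length v)

  -- The exchange condition: deleting a letter at which the strands `x` and `y` cross exchanges
  -- their images and affects no other strand.
  exchange : All L w → x < y → ev w y < ev w x →
             ∃[ v ] All L v × length w ≡ suc (length v) × Exchanged x y (ev w) (ev v)
  exchange {w = []} [] x<y y<x = contradiction y<x (<-asym x<y)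
  exchange {w = i ∷ w} {x} {y} (p ∷ ps) x<y inv with <-cmp (ev w y) (ev w x)
  ... | tri< lt _ _ with exchange ps x<y lt
  ...   | v , qs , len , ex , ey , ez = i ∷ v , p ∷ qs , cong suc len ,
          cong (sw i) ex , cong (sw i) ey , λ z≢x z≢y → cong (sw i) (ez z≢x z≢y)
  exchange {w = i ∷ w} {x} {y} (p ∷ ps) x<y inv | tri≈ _ eq _ =
    contradiction (ev-injective w eq) (>⇒≢ x<y)
  exchange {w = i ∷ w} {x} {y} (p ∷ ps) x<y inv | tri> _ _ gt with sw-inverts gt inv
  ... | ex , ey = w , ps , refl ,
    trans ex (sym (trans (cong (sw i) ey) (sw-suc i))) ,
    trans ey (sym (trans (cong (sw i) ex) (jump-at i (suc i)))) ,
    λ z≢x z≢y → sym (sw-off (λ e → z≢x (ev-injective w (trans e (sym ex))))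
                            (λ e → z≢y (ev-injective w (trans e (sym ey)))))

  red-++ˡ : ∀ u → Red (u ++ v) → Red u
  red-++ˡ {v} u (ps , min) = All.++⁻ˡ u ps , λ w qs eq →
    +-cancelʳ-≤ (length v) _ _ (subst₂ _≤_ (length-++ u) (length-++ w)
      (min (w ++ v) (All.++⁺ qs (All.++⁻ʳ u ps))
        (λ x → trans (ev-++ w v x) (trans (eq (ev v x)) (sym (ev-++ u v x))))))

  red-++ʳ : ∀ u → Red (u ++ v) → Red v
  red-++ʳ {v} u (ps , min) = All.++⁻ʳ u ps , λ w qs eq →
    +-cancelˡ-≤ (length u) _ _ (subst₂ _≤_ (length-++ u) (length-++ u)
      (min (u ++ w) (All.++⁺ (All.++⁻ˡ u ps) qs)
        (λ x → trans (ev-++ u w x) (trans (cong (ev u) (eq x)) (sym (ev-++ u v x))))))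

  red-reverse : Red w → Red (reverse w)
  red-reverse {w} (ps , min) = All-reverse ps , λ v qs eq →
    subst₂ _≤_ (sym (length-reverse w)) (length-reverse v)
      (min (reverse v) (All-reverse qs) λ x → begin
        ev (reverse v) x                                ≡⟨ cong (ev (reverse v)) (ev-reverse w x) ⟨
        ev (reverse v) (ev (reverse w) (ev w x))        ≡⟨ cong (ev (reverse v)) (eq (ev w x)) ⟨
        ev (reverse v) (ev v (ev w x))                  ≡⟨ ev-reverse v (ev w x) ⟩
        ev w x                                          ∎)
    where open ≡-Reasoning

  -- Two strands that cross in both parts of a word can be uncrossed in both,
  -- which saves two letters.

  red-NoDouble : ∀ u v → Red (u ++ v) → NoDouble (ev u) (ev (reverse v))
  red-NoDouble u v (ps , min) {x} {y} x<y inv₁ inv₂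
    with exchange (All.++⁻ˡ u ps) x<y inv₁ | exchange (All-reverse (All.++⁻ʳ u ps)) x<y inv₂
  ... | u′ , qs , lenᵤ , ux , uy , uz | v′ , rs , lenᵥ , vx , vy , vz =
    contradiction (min (u′ ++ reverse v′) (All.++⁺ qs (All-reverse rs)) same) (<⇒≱ shorter)
    where
    shorter : length (u′ ++ reverse v′) < length (u ++ v)
    shorter = begin-strict
      length (u′ ++ reverse v′)       ≡⟨ length-++ u′ ⟩
      length u′ + length (reverse v′) ≡⟨ cong (length u′ +_) (length-reverse v′) ⟩
      length u′ + length v′           <⟨ +-mono-<-≤ (≤-reflexive (sym lenᵤ)) (n≤1+n _) ⟩
      length u + suc (length v′)      ≡⟨ cong (length u +_) (trans (sym lenᵥ) (length-reverse v)) ⟩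
      length u + length v             ≡⟨ length-++ u ⟨
      length (u ++ v)                 ∎
      where open ≤-Reasoning

    at : ∀ t s → ev v′ t ≡ ev (reverse v) s → ev u′ t ≡ ev u s →
         ev (u′ ++ reverse v′) (ev v′ t) ≡ ev (u ++ v) (ev v′ t)
    at t s eqᵥ eqᵤ = begin
      ev (u′ ++ reverse v′) (ev v′ t)       ≡⟨ ev-++ u′ (reverse v′) _ ⟩
      ev u′ (ev (reverse v′) (ev v′ t))     ≡⟨ cong (ev u′) (ev-reverse v′ t) ⟩
      ev u′ t                               ≡⟨ eqᵤ ⟩
      ev u s                                ≡⟨ cong (ev u) (ev-reverseʳ v s) ⟨
      ev u (ev v (ev (reverse v) s))        ≡⟨ cong (ev u ∘ ev v) eqᵥ ⟨
      ev u (ev v (ev v′ t))                 ≡⟨ ev-++ u v _ ⟨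
      ev (u ++ v) (ev v′ t)                 ∎
      where open ≡-Reasoning

    same′ : ∀ t → ev (u′ ++ reverse v′) (ev v′ t) ≡ ev (u ++ v) (ev v′ t)
    same′ t with t ≟ x | t ≟ y
    ... | yes refl | _        = at t y vx ux
    ... | no _     | yes refl = at t x vy uy
    ... | no t≢x   | no t≢y   = at t t (vz t≢x t≢y) (uz t≢x t≢y)

    same : ∀ z → ev (u′ ++ reverse v′) z ≡ ev (u ++ v) z
    same z = subst (λ z → ev (u′ ++ reverse v′) z ≡ ev (u ++ v) z) (ev-reverseʳ v′ z) (same′ (ev (reverse v′) z))

  -- The letter `i` crosses the strands at `i` and `i + 1`, so a crossing of them in `u` would be
  -- the second one.
  red-ascent : ∀ u → Red (u ++ i ∷ v) → ¬ (ev u (suc i) < ev u i)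
  red-ascent {i} {v} u red inv = red-NoDouble u [ i ]
    (red-++ˡ (u ++ [ i ]) (subst Red (sym (++-assoc u [ i ] v)) red)) (n<1+n i) inv
    (subst₂ _<_ (sym (sw-suc i)) (sym (jump-at i (suc i))) (n<1+n i))

-- Runs and arms of words

rise : ℕ → ℕ → List ℕ
rise a zero    = []
rise a (suc k) = a ∷ rise (suc a) k

fall : ℕ → ℕ → List ℕ
fall a zero    = []
fall a (suc k) = a + k ∷ fall a k

jump-refl : ∀ x z → jump x x z ≡ z
jump-refl x z with <-cmp z x
... | tri< z<x _ _  = jump-< z<x z<x
... | tri≈ _ refl _ = jump-at x x
... | tri> _ _ x<z  = jump-> x<z x<z

sw-jump-down : ∀ z → x < y → sw x (jump y (suc x) z) ≡ jump y x z
sw-jump-down {x} {y} z x<y with <-cmp z y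
... | tri≈ _ refl _ = trans (cong (sw x) (jump-at z (suc x))) (trans (sw-suc x) (sym (jump-at z x)))
... | tri> _ _ y<z = trans (cong (sw x) (jump-> y<z (≤-<-trans x<y y<z)))
                       (trans (jump-> (<-trans x<y y<z) (≤-<-trans x<y y<z)) (sym (jump-> y<z (<-trans x<y y<z))))
... | tri< z<y _ _ with <-cmp z x
...   | tri< z<x _ _  = trans (cong (sw x) (jump-< z<y (m<n⇒m<1+n z<x)))
                          (trans (jump-< z<x (m<n⇒m<1+n z<x)) (sym (jump-< z<y z<x)))
...   | tri≈ _ refl _ = trans (cong (sw x) (jump-< z<y ≤-refl)) (trans (jump-at x (suc x)) (sym (jump-down ≤-refl z<y)))
...   | tri> _ _ x<z  = trans (cong (sw x) (jump-down x<z z<y))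
                          (trans (jump-> (m<n⇒m<1+n x<z) (s≤s x<z)) (sym (jump-down (<⇒≤ x<z) z<y)))

sw-jump-up : ∀ z → x ≤ y → sw y (jump x y z) ≡ jump x (suc y) z
sw-jump-up {x} {y} z x≤y with <-cmp z x
... | tri≈ _ refl _ = trans (cong (sw y) (jump-at z y)) (trans (jump-at y (suc y)) (sym (jump-at z (suc y))))
... | tri< z<x _ _  = trans (cong (sw y) (jump-< z<x (<-≤-trans z<x x≤y)))
                        (trans (jump-< (<-≤-trans z<x x≤y) (m<n⇒m<1+n (<-≤-trans z<x x≤y)))
                          (sym (jump-< z<x (m<n⇒m<1+n (<-≤-trans z<x x≤y)))))
sw-jump-up {x} {y} (suc z) x≤y | tri> _ _ (s≤s x≤z) with <-cmp z y
... | tri< z<y _ _  = trans (cong (sw y) (jump-up x≤z z<y))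
                        (trans (jump-< z<y (m<n⇒m<1+n z<y)) (sym (jump-up x≤z (m<n⇒m<1+n z<y))))
... | tri≈ _ refl _ = trans (cong (sw y) (jump-> (s≤s x≤z) ≤-refl)) (trans (sw-suc y) (sym (jump-up x≤z ≤-refl)))
... | tri> _ _ y<z  = trans (cong (sw y) (jump-> (s≤s x≤z) (m<n⇒m<1+n y<z)))
                        (trans (jump-> (m<n⇒m<1+n y<z) (s≤s y<z)) (sym (jump-> (s≤s x≤z) (s≤s y<z))))

-- The rightmost letter acts first, so a rise carries its top point down.
ev-rise : ∀ a k z → ev (rise a k) z ≡ jump (a + k) a z
ev-rise a zero    z rewrite +-identityʳ a = sym (jump-refl a z)
ev-rise a (suc k) z rewrite +-suc a k = trans (cong (sw a) (ev-rise (suc a) k z)) (sw-jump-down z (s≤s (m≤m+n a k)))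

ev-fall : ∀ a k z → ev (fall a k) z ≡ jump a (a + k) z
ev-fall a zero    z rewrite +-identityʳ a = sym (jump-refl a z)
ev-fall a (suc k) z rewrite +-suc a k = trans (cong (sw (a + k)) (ev-fall a k z)) (sw-jump-up z (m≤m+n a k))

fall-last : ∀ a k → fall a (suc k) ≡ fall (suc a) k ++ [ a ]
fall-last a zero    = cong [_] (+-identityʳ a)
fall-last a (suc k) = cong₂ _∷_ (+-suc a k) (fall-last a k)

reverse-rise : ∀ a k → reverse (rise a k) ≡ fall a k
reverse-rise a zero    = refl
reverse-rise a (suc k) = begin
  reverse (a ∷ rise (suc a) k)   ≡⟨ unfold-reverse a (rise (suc a) k) ⟩
  reverse (rise (suc a) k) ++ [ a ] ≡⟨ cong (_++ [ a ]) (reverse-rise (suc a) k) ⟩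
  fall (suc a) k ++ [ a ]        ≡⟨ fall-last a k ⟨
  fall a (suc k)                 ∎
  where open ≡-Reasoning

reverse-fall : ∀ a k → reverse (fall a k) ≡ rise a k
reverse-fall a k = trans (cong reverse (sym (reverse-rise a k))) (reverse-involutive (rise a k))

rise-bounds : ∀ a k → All (λ i → a ≤ i × i < a + k) (rise a k)
rise-bounds a zero    = []
rise-bounds a (suc k) rewrite +-suc a k =
  (≤-refl , s≤s (m≤m+n a k)) ∷ All.map (λ (p , q) → <⇒≤ p , q) (rise-bounds (suc a) k)

fall-bounds : ∀ a k → All (λ i → a ≤ i × i < a + k) (fall a k)
fall-bounds a zero    = []
fall-bounds a (suc k) rewrite +-suc a k =
  (m≤m+n a k , ≤-refl) ∷ All.map (λ (p , q) → p , m<n⇒m<1+n q) (fall-bounds a k)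

module _ {P : Pred ℕ 0ℓ} where

  rise-top : ∀ a k → All P (rise a (suc k)) → P (a + k)
  rise-top a zero    (p ∷ _)  = subst P (sym (+-identityʳ a)) p
  rise-top a (suc k) (_ ∷ ps) = subst P (sym (+-suc a k)) (rise-top (suc a) k ps)

  fall-bottom : ∀ a k → All P (fall a (suc k)) → P a
  fall-bottom a k ps = All.head (All.++⁻ʳ (fall (suc a) k) (subst (All P) (fall-last a k) ps))

Adj : ℕ → ℕ → Set
Adj i j = j ≡ suc i ⊎ i ≡ suc j

-- What may follow when a run turns: the next letter is prescribed, or the word ends. An upward arm
-- from `lo` needs `From (suc lo)`, a downward arm from `hi` needs `Below hi`.
data From (a : ℕ) : List ℕ → Set where
  []   : From a []
  more : ∀ {w} → From a (a ∷ w)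

data Below (a : ℕ) : List ℕ → Set where
  []   : Below a []
  more : ∀ {i w} → suc i ≡ a → Below a (i ∷ w)

split-rise : ∀ l w → Linked Adj (l ∷ w) → ∃[ k ] ∃[ v ] l ∷ w ≡ rise l (suc k) ++ v × Below (l + k) v × Linked Adj v
split-rise l []      _ = 0 , [] , refl , [] , []
split-rise l (j ∷ w) (inj₁ refl ∷ adj) with split-rise (suc l) w adj
... | k , v , eq , bel , adj′ = suc k , v , cong (l ∷_) eq , subst (λ a → Below a v) (sym (+-suc l k)) bel , adj′
split-rise l (j ∷ w) (inj₂ refl ∷ adj) = 0 , j ∷ w , refl , more (sym (+-identityʳ l)) , adj

split-fall : ∀ h w → Linked Adj (h ∷ w) →
             ∃[ e ] ∃[ k ] ∃[ v ] h ≡ e + k × h ∷ w ≡ fall e (suc k) ++ v × From (suc e) v × Linked Adj v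
split-fall h []      _ = h , 0 , [] , sym (+-identityʳ h) , cong [_] (sym (+-identityʳ h)) , [] , []
split-fall h (j ∷ w) (inj₁ refl ∷ adj) =
  h , 0 , j ∷ w , sym (+-identityʳ h) , cong (λ i → i ∷ j ∷ w) (sym (+-identityʳ h)) , more , adj
split-fall h (j ∷ w) (inj₂ refl ∷ adj) with split-fall j w adj
... | e , k , v , eq , eqw , from , adj′ =
  e , suc k , v , trans (cong suc eq) (sym (+-suc e k)) ,
  cong₂ _∷_ (trans (cong suc eq) (sym (+-suc e k))) eqw , from , adj′

-- After the first run, `h` and `l` are the letters at which the previous run ended. Hence a run has
-- the letters `h - 1 … e` or `l + 1 … f`, without the turning letter.
wDown : ℕ → List ℕ → List ℕ
wUp   : ℕ → List ℕ → List ℕ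

wDown h []      = []
wDown h (e ∷ A) = fall e (h ∸ e) ++ wUp e A
wUp l []        = []
wUp l (f ∷ A)   = rise (suc l) (f ∸ l) ++ wDown f A

mutual
  wDown-bounds : ∀ A → Down lo hi A → All (λ i → lo ≤ i × i < hi) (wDown hi A)
  wDown-bounds []      _ = []
  wDown-bounds {lo} {hi} (e ∷ A) (lo≤e , e<hi , u) = All.++⁺
    (All.map (λ (p , q) → ≤-trans lo≤e p , subst (_ <_) (m+[n∸m]≡n (<⇒≤ e<hi)) q) (fall-bounds e (hi ∸ e)))
    (All.map (λ (p , q) → ≤-trans lo≤e (<⇒≤ p) , ≤-<-trans q (pred-< e<hi)) (wUp-bounds A u))

  wUp-bounds : ∀ A → Up lo hi A → All (λ i → lo < i × i ≤ hi) (wUp lo A)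
  wUp-bounds []      _ = []
  wUp-bounds {lo} {hi} (f ∷ A) (lo<f , f≤hi , v) = All.++⁺
    (All.map (λ (p , q) → p , ≤-trans (≤-pred (≤-trans q (≤-reflexive (cong suc (m+[n∸m]≡n (<⇒≤ lo<f)))))) f≤hi)
      (rise-bounds (suc lo) (f ∸ lo)))
    (All.map (λ (p , q) → p , ≤-trans (<⇒≤ q) f≤hi) (wDown-bounds A v))

map-suc-pred : ∀ {lo} w → All (lo <_) w → map suc (map pred w) ≡ w
map-suc-pred []          _        = refl
map-suc-pred (suc i ∷ w) (_ ∷ ps) = cong (suc i ∷_) (map-suc-pred w ps)

map-pred-rise : ∀ a k → map pred (rise (suc a) k) ≡ rise a k
map-pred-rise a zero    = refl
map-pred-rise a (suc k) = cong (a ∷_) (map-pred-rise (suc a) k)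

-- The shift by pred comes from moving the letters of an upward arm past the run
-- that precedes it.

mutual
  ev-wDown : ∀ A → Down lo hi A → ∀ z → ev (reverse (wDown hi A)) z ≡ jumps hi A z
  ev-wDown []      _ z = refl
  ev-wDown {lo} {hi} (e ∷ A) (lo≤e , e<hi , u) z = begin
    ev (reverse (fall e k ++ wUp e A)) z                  ≡⟨ cong (λ v → ev v z) (reverse-++ (fall e k) (wUp e A)) ⟩
    ev (reverse (wUp e A) ++ reverse (fall e k)) z        ≡⟨ ev-++ (reverse (wUp e A)) _ z ⟩
    ev (reverse (wUp e A)) (ev (reverse (fall e k)) z)    ≡⟨ cong (ev (reverse (wUp e A))) rev ⟩
    ev (reverse (wUp e A)) (jump hi e z)                  ≡⟨ cong (λ v → ev v (jump hi e z)) shift ⟨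
    ev (map suc W) (jump hi e z)                          ≡⟨ ev-conj (jump-injective hi e) shifts bounds z ⟩
    jump hi e (ev W z)                                    ≡⟨ cong (jump hi e) (ev-wUp A u z) ⟩
    jump hi e (jumps e A z)                               ∎
    where
    open ≡-Reasoning
    k = hi ∸ e
    W = reverse (map pred (wUp e A))
    rev : ev (reverse (fall e k)) z ≡ jump hi e z
    rev = trans (cong (λ v → ev v z) (reverse-fall e k))
            (trans (ev-rise e k z) (cong (λ h → jump h e z) (m+[n∸m]≡n (<⇒≤ e<hi))))
    shift : map suc W ≡ reverse (wUp e A)
    shift = trans (reverse-map suc (map pred (wUp e A)))
              (cong reverse (map-suc-pred (wUp e A) (All.map proj₁ (wUp-bounds A u))))
    bounds : All (λ i → e ≤ i × suc i < hi) W
    bounds = All-reverse (All.map⁺ (All.map (λ { {suc i} (s≤s p , q) → p , ≤-<-trans q (pred-< e<hi) }) (wUp-bounds A u)))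
    shifts : ∀ {i} → e ≤ i × suc i < hi → jump hi e i ≡ suc i × jump hi e (suc i) ≡ suc (suc i)
    shifts (p , q) = jump-down p (<-trans (n<1+n _) q) , jump-down (m≤n⇒m≤1+n p) q

  ev-wUp : ∀ A → Up lo hi A → ∀ z → ev (reverse (map pred (wUp lo A))) z ≡ jumps lo A z
  ev-wUp []      _ z = refl
  ev-wUp {lo} {hi} (f ∷ A) (lo<f , f≤hi , v) z = begin
    ev (reverse (map pred (rise (suc lo) k ++ wDown f A))) z
      ≡⟨ cong (λ w → ev (reverse w) z) (trans (map-++ pred (rise (suc lo) k) (wDown f A))
           (cong (_++ map pred (wDown f A)) (map-pred-rise lo k))) ⟩
    ev (reverse (rise lo k ++ map pred (wDown f A))) z
      ≡⟨ cong (λ v → ev v z) (reverse-++ (rise lo k) (map pred (wDown f A))) ⟩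
    ev (reverse (map pred (wDown f A)) ++ reverse (rise lo k)) z
      ≡⟨ ev-++ (reverse (map pred (wDown f A))) _ z ⟩
    ev (reverse (map pred (wDown f A))) (ev (reverse (rise lo k)) z)
      ≡⟨ cong (ev (reverse (map pred (wDown f A)))) rev ⟩
    ev (reverse (map pred (wDown f A))) (jump lo f z)
      ≡⟨ cong (λ v → ev v (jump lo f z)) (reverse-map pred (wDown f A)) ⟨
    ev (map pred (reverse (wDown f A))) (jump lo f z)
      ≡⟨ ev-conj (jump-injective lo f) shifts (All-reverse (wDown-bounds A v)) z ⟩
    jump lo f (ev (reverse (wDown f A)) z)
      ≡⟨ cong (jump lo f) (ev-wDown A v z) ⟩
    jump lo f (jumps f A z)
      ∎
    where
    open ≡-Reasoning
    k = f ∸ lo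
    rev : ev (reverse (rise lo k)) z ≡ jump lo f z
    rev = trans (cong (λ v → ev v z) (reverse-rise lo k))
            (trans (ev-fall lo k z) (cong (λ h → jump lo h z) (m+[n∸m]≡n (<⇒≤ lo<f))))
    shifts : ∀ {i} → suc lo ≤ i × i < f → jump lo f i ≡ pred i × jump lo f (suc i) ≡ suc (pred i)
    shifts {suc i} (s≤s p , q) = jump-up p (<-trans (n<1+n i) q) , jump-up (m≤n⇒m≤1+n p) q

module Arms (L : Pred ℕ 0ℓ) where

  open Reduced L

  -- A rise from l to f followed by letters below f sends f + 1 to l, which lies
  -- below the image of f; hence the letter f cannot come next.

  rise-stays : ∀ l k u {i w} → All (λ j → l ≤ j × j < l + k) u → Red ((rise l (suc k) ++ u) ++ w) →
               Linked Adj (i ∷ w) → i < l + k → All (l ≤_) w → All (λ j → l ≤ j × j < l + k) w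
  rise-stays l k u {i} {[]}    us red adj         i<f _          = []
  rise-stays l k u {i} {c ∷ w} us red (adj ∷ adjs) i<f (l≤c ∷ ls) with <-cmp c (l + k)
  ... | tri< c<f _ _ = (l≤c , c<f) ∷ rise-stays l k (u ++ [ c ]) (All.++⁺ us ((l≤c , c<f) ∷ []))
    (subst Red (trans (++-assoc (rise l (suc k)) u (c ∷ w)) (sym (trans (cong (_++ w) (sym (++-assoc (rise l (suc k)) u [ c ])))
       (trans (++-assoc (rise l (suc k) ++ u) [ c ] w) (++-assoc (rise l (suc k)) u (c ∷ w)))))) red) adjs c<f ls
  ... | tri> _ _ f<c = contradiction f<c (≤⇒≯ (≤-trans (c≤1+i adj) i<f))
    where
    c≤1+i : ∀ {c i} → Adj i c → c ≤ suc i
    c≤1+i (inj₁ refl) = ≤-refl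
    c≤1+i (inj₂ refl) = m≤n⇒m≤1+n (n≤1+n _)
  ... | tri≈ _ refl _ = contradiction descent (red-ascent (rise l (suc k) ++ u) red)
    where
    f = l + k
    run : ∀ z → ev (rise l (suc k) ++ u) z ≡ jump (suc f) l (ev u z)
    run z = trans (ev-++ (rise l (suc k)) u z)
      (trans (ev-rise l (suc k) _) (cong (λ h → jump h l (ev u z)) (+-suc l k)))
    top : ev (rise l (suc k) ++ u) (suc f) ≡ l
    top = trans (run (suc f)) (trans (cong (jump (suc f) l) (ev-fixes-> (All.map (s≤s ∘ proj₂) us))) (jump-at (suc f) l))
    descent : ev (rise l (suc k) ++ u) (suc f) < ev (rise l (suc k) ++ u) f
    descent = subst₂ _<_ (sym top) (sym (trans (run f) (jump-down l≤ (s≤s ≤f)))) (s≤s l≤)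
      where
      l≤ : l ≤ ev u f
      l≤ = ev-≥ u (All.map proj₁ us) (m≤m+n l k)
      ≤f : ev u f ≤ f
      ≤f = ev-≤ u (All.map proj₂ us) ≤-refl

  fall-stays : ∀ e k u {i w} → All (λ j → e < j × j ≤ e + k) u → Red ((fall e (suc k) ++ u) ++ w) →
               Linked Adj (i ∷ w) → e < i → All (_≤ e + k) w → All (λ j → e < j × j ≤ e + k) w
  fall-stays e k u {i} {[]}    us red adj         e<i _          = []
  fall-stays e k u {i} {c ∷ w} us red (adj ∷ adjs) e<i (c≤h ∷ hs) with <-cmp e c
  ... | tri< e<c _ _ = (e<c , c≤h) ∷ fall-stays e k (u ++ [ c ]) (All.++⁺ us ((e<c , c≤h) ∷ []))
    (subst Red (trans (++-assoc (fall e (suc k)) u (c ∷ w)) (sym (trans (cong (_++ w) (sym (++-assoc (fall e (suc k)) u [ c ])))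
       (trans (++-assoc (fall e (suc k) ++ u) [ c ] w) (++-assoc (fall e (suc k)) u (c ∷ w)))))) red) adjs e<c hs
  ... | tri> _ _ c<e = contradiction (≤-trans e<i (i≤1+c adj)) (≤⇒≯ c<e)
    where
    i≤1+c : ∀ {c i} → Adj i c → i ≤ suc c
    i≤1+c (inj₁ refl) = m≤n⇒m≤1+n (n≤1+n _)
    i≤1+c (inj₂ refl) = ≤-refl
  ... | tri≈ _ refl _ = contradiction descent (red-ascent (fall e (suc k) ++ u) red)
    where
    h = e + k
    run : ∀ z → ev (fall e (suc k) ++ u) z ≡ jump e (suc h) (ev u z)
    run z = trans (ev-++ (fall e (suc k)) u z)
      (trans (ev-fall e (suc k) _) (cong (λ h → jump e h (ev u z)) (+-suc e k)))
    bottom : ev (fall e (suc k) ++ u) e ≡ suc h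
    bottom = trans (run e) (trans (cong (jump e (suc h)) (ev-fixes-< (All.map proj₁ us))) (jump-at e (suc h)))
    e<ev : e < ev u (suc e)
    e<ev = ev-≥ u (All.map proj₁ us) ≤-refl
    ev≤h : ev u (suc e) ≤ suc h
    ev≤h = ev-≤ u (All.map (s≤s ∘ proj₂) us) (s≤s (m≤m+n e k))
    shifted : ∀ x → e < x → x ≤ suc h → jump e (suc h) x < suc h
    shifted (suc x) (s≤s e≤x) x≤h = subst (_< suc h) (sym (jump-up e≤x x≤h)) x≤h
    descent : ev (fall e (suc k) ++ u) (suc e) < ev (fall e (suc k) ++ u) e
    descent = subst₂ _<_ (sym (run (suc e))) (sym bottom) (shifted _ e<ev ev≤h)

linked-++ʳ : ∀ u → Linked Adj (u ++ v) → Linked Adj v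
linked-++ʳ []          adj       = adj
linked-++ʳ (i ∷ u)     adj       = linked-++ʳ u (Linked.tail adj)

linked-++ˡ : ∀ u → Linked Adj (u ++ v) → Linked Adj u
linked-++ˡ []          adj       = []
linked-++ˡ (i ∷ [])    adj       = [-]
linked-++ˡ (i ∷ j ∷ u) (a ∷ adj) = a ∷ linked-++ˡ (j ∷ u) adj

adj-sym : Adj i j → Adj j i
adj-sym (inj₁ p) = inj₂ p
adj-sym (inj₂ p) = inj₁ p

linked-reverse : ∀ w → Linked Adj w → Linked Adj (reverse w)
linked-reverse []      _   = []
linked-reverse (i ∷ w) adj = go i [] w [-] adj
  where
  go : ∀ i acc w → Linked Adj (i ∷ acc) → Linked Adj (i ∷ w) → Linked Adj (reverseAcc (i ∷ acc) w)
  go i acc []      adj₁ _          = adj₁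
  go i acc (j ∷ w) adj₁ (a ∷ adj₂) = go j (i ∷ acc) w (adj-sym a ∷ adj₁) adj₂

from-adj : ∀ {w} → Linked Adj (x ∷ w) → All (x <_) w → From (suc x) w
from-adj {w = []}    _               _       = []
from-adj {w = _ ∷ _} (inj₁ refl ∷ _) _       = more
from-adj {w = _ ∷ _} (inj₂ refl ∷ _) (p ∷ _) = contradiction p (<-asym ≤-refl)

below-adj : ∀ {w} → Linked Adj (x ∷ w) → All (_< x) w → Below x w
below-adj {w = []}    _               _       = []
below-adj {w = _ ∷ _} (inj₁ refl ∷ _) (p ∷ _) = contradiction p (<-asym ≤-refl)
below-adj {w = _ ∷ _} (inj₂ refl ∷ _) _       = more refl

linked-before : ∀ u → Linked Adj (u ++ x ∷ v) → Linked Adj (x ∷ reverse u)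
linked-before {x} {v} u adj = linked-++ʳ (reverse v) (subst (Linked Adj) eq (linked-reverse _ adj))
  where
  eq : reverse (u ++ x ∷ v) ≡ reverse v ++ x ∷ reverse u
  eq = trans (reverse-++ u (x ∷ v))
    (trans (cong (_++ reverse u) (unfold-reverse x v)) (++-assoc (reverse v) [ x ] (reverse u)))

reverse⁻ : ∀ {w u : List ℕ} → reverse w ≡ u → w ≡ reverse u
reverse⁻ {w} eq = trans (sym (reverse-involutive w)) (cong reverse eq)

reverse-∷⁻ : ∀ {w u : List ℕ} → reverse w ≡ x ∷ u → w ≡ reverse u ++ [ x ]
reverse-∷⁻ {x} {w} {u} eq = trans (reverse⁻ eq) (unfold-reverse x u)

reverse-≗ : ∀ u v → (∀ x → ev u x ≡ ev v x) → ∀ x → ev (reverse u) x ≡ ev (reverse v) x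
reverse-≗ u v eq x = begin
  ev (reverse u) x                           ≡⟨ cong (ev (reverse u)) (ev-reverseʳ v x) ⟨
  ev (reverse u) (ev v (ev (reverse v) x))   ≡⟨ cong (ev (reverse u)) (eq _) ⟨
  ev (reverse u) (ev u (ev (reverse v) x))   ≡⟨ ev-reverse u _ ⟩
  ev (reverse v) x                           ∎
  where open ≡-Reasoning

-- The shape of reduced words without commutations

record Ascends (p q : ℕ) (w : List ℕ) : Set where
  field
    k         : ℕ
    top       : p + k ≡ q
    pre post  : List ℕ
    word      : w ≡ pre ++ rise p (suc k) ++ post
    pre-in    : All (λ i → p < i × i < q) pre
    post-in   : All (λ i → p < i × i < q) post
    pre-from  : From (suc p) (reverse pre)
    post-from : Below q post

Starts : ℕ → List ℕ → Set
Starts x w = ∃[ v ] w ≡ x ∷ v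

Swaps : ℕ → ℕ → (ℕ → ℕ) → Set
Swaps p q σ = σ (suc q) ≡ p × σ p ≡ suc q

data Shape (p q : ℕ) (w : List ℕ) : Set where
  ascending  : Ascends p q w → Shape p q w
  descending : Ascends p q (reverse w) → Shape p q w
  extremal   : Swaps p q (ev w) →
               (Starts p w ⊎ Starts q w) ⊎ (Starts p (reverse w) ⊎ Starts q (reverse w)) → Shape p q w

extremes : ∀ i w → ∃[ p ] ∃[ q ] All (λ j → p ≤ j × j ≤ q) (i ∷ w) × p ∈ i ∷ w × q ∈ i ∷ w
extremes i [] = i , i , (≤-refl , ≤-refl) ∷ [] , here refl , here refl
extremes i (j ∷ w) with extremes j w
... | p , q , bs , p∈ , q∈ with ≤-total i p | ≤-total i q
...   | inj₁ i≤p | inj₁ i≤q = i , q , (≤-refl , i≤q) ∷ All.map (λ (a , b) → ≤-trans i≤p a , b) bs , here refl , there q∈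
...   | inj₁ i≤p | inj₂ q≤i = i , i , (≤-refl , ≤-refl) ∷ All.map (λ (a , b) → ≤-trans i≤p a , ≤-trans b q≤i) bs , here refl , here refl
...   | inj₂ p≤i | inj₁ i≤q = p , q , (p≤i , i≤q) ∷ bs , there p∈ , there q∈
...   | inj₂ p≤i | inj₂ q≤i = p , i , (p≤i , ≤-refl) ∷ All.map (λ (a , b) → a , ≤-trans b q≤i) bs , there p∈ , here refl

firstOf : ∀ p q w → p ∈ w → ∃[ u ] ∃[ x ] ∃[ v ] w ≡ u ++ x ∷ v × (x ≡ p ⊎ x ≡ q) × All (λ i → i ≢ p × i ≢ q) u
firstOf p q (i ∷ w) p∈ with i ≟ p | i ≟ q
... | yes i≡p | _       = [] , i , w , refl , inj₁ i≡p , []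
... | no _    | yes i≡q = [] , i , w , refl , inj₂ i≡q , []
firstOf p q (i ∷ w) (here refl) | no i≢p | no _ = contradiction refl i≢p
firstOf p q (i ∷ w) (there p∈)  | no i≢p | no i≢q with firstOf p q w p∈
... | u , x , v , eq , xpq , us = i ∷ u , x , v , cong (i ∷_) eq , xpq , (i≢p , i≢q) ∷ us

module Words (L : Pred ℕ 0ℓ) where

  open Reduced L
  open Arms L

  Realises : (ℕ → ℕ) → List ℕ → Set
  Realises σ w = Red w × Linked Adj w × (∀ x → ev w x ≡ σ x)

  -- Once the run has turned, `rise-stays` traps the rest of the word below its top.
  run-up : ∀ l w → Linked Adj (l ∷ w) → Red (l ∷ w) → All (l ≤_) w →
           ∃[ k ] ∃[ v ] l ∷ w ≡ rise l (suc k) ++ v × Below (l + k) v × Linked Adj v ×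
           All (λ j → l ≤ j × j < l + k) v
  run-up l w adj red ls with split-rise l w adj
  ... | k , v , eq , bel , adj′ = k , v , eq , bel , adj′ ,
        stays v bel adj′ (subst Red eq red) (All.++⁻ʳ (rise l (suc k)) (subst (All (l ≤_)) eq (≤-refl ∷ ls)))
    where
    stays : ∀ v → Below (l + k) v → Linked Adj v → Red (rise l (suc k) ++ v) → All (l ≤_) v →
            All (λ j → l ≤ j × j < l + k) v
    stays []      _          _    _   _         = []
    stays (i ∷ v) (more eq) adj red (l≤i ∷ ls) = bound ∷
      rise-stays l k [ i ] (bound ∷ []) (subst Red (sym (++-assoc (rise l (suc k)) [ i ] v)) red) adj (proj₂ bound) ls
      where bound = l≤i , ≤-reflexive eq

  run-down : ∀ h w → Linked Adj (h ∷ w) → Red (h ∷ w) → All (_≤ h) w →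
             ∃[ e ] ∃[ k ] ∃[ v ] h ≡ e + k × h ∷ w ≡ fall e (suc k) ++ v × From (suc e) v × Linked Adj v ×
             All (λ j → e < j × j ≤ h) v
  run-down h w adj red hs with split-fall h w adj
  ... | e , k , v , refl , eq , from , adj′ = e , k , v , refl , eq , from , adj′ ,
        stays v from adj′ (subst Red eq red) (All.++⁻ʳ (fall e (suc k)) (subst (All (_≤ h)) eq (≤-refl ∷ hs)))
    where
    stays : ∀ v → From (suc e) v → Linked Adj v → Red (fall e (suc k) ++ v) → All (_≤ e + k) v →
            All (λ j → e < j × j ≤ e + k) v
    stays []      _    _    _   _          = []
    stays (i ∷ v) more adj red (i≤h ∷ hs) = bound ∷
      fall-stays e k [ i ] (bound ∷ []) (subst Red (sym (++-assoc (fall e (suc k)) [ i ] v)) red) adj ≤-refl hs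
      where bound = ≤-refl , i≤h

  mutual
    -- The range in which `run-down` traps the rest is the hypothesis of `arm-up`, and conversely;
    -- so a word that starts at the edge of its range is an arm throughout. `n` bounds the length.
    arm-down : ∀ n w → length w ≤ n → Linked Adj w → Red w → All (λ i → lo ≤ i × i < hi) w → Below hi w →
               ∃[ A ] Down lo hi A × w ≡ wDown hi A
    arm-down n [] _ _ _ _ _ = [] , tt , refl
    arm-down {lo} (suc n) (i ∷ w) (s≤s len) adj red bs (more refl)
      with run-down i w adj red (All.map (≤-pred ∘ proj₂) (All.tail bs))
    ... | e , k , v , refl , eq , from , adj′ , vs
      with arm-up n v shorter adj′ (red-++ʳ (fall e (suc k)) (subst Red eq red)) vs from
      where
      shorter : length v ≤ n
      shorter = ≤-trans (≤-trans (m≤n+m (length v) (length (fall e k)))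
        (≤-reflexive (sym (trans (cong length (∷-injectiveʳ eq)) (length-++ (fall e k)))))) len
    ... | A , u , refl = e ∷ A ,
      (proj₁ (fall-bottom e k (All.++⁻ˡ (fall e (suc k)) (subst (All _) eq bs))) , s≤s (m≤m+n e k) , u) ,
      trans eq (cong (λ m → fall e m ++ wUp e A) (sym (trans (cong (_∸ e) (sym (+-suc e k))) (m+n∸m≡n e (suc k)))))

    arm-up : ∀ n w → length w ≤ n → Linked Adj w → Red w → All (λ i → lo < i × i ≤ hi) w → From (suc lo) w →
             ∃[ A ] Up lo hi A × w ≡ wUp lo A
    arm-up n [] _ _ _ _ _ = [] , tt , refl
    arm-up {lo} {hi} (suc n) (_ ∷ w) (s≤s len) adj red bs more
      with run-up (suc lo) w adj red (All.map proj₁ (All.tail bs))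
    ... | k , v , eq , bel , adj′ , vs
      with arm-down n v shorter adj′ (red-++ʳ (rise (suc lo) (suc k)) (subst Red eq red)) vs bel
      where
      shorter : length v ≤ n
      shorter = ≤-trans (≤-trans (m≤n+m (length v) (length (rise (suc (suc lo)) k)))
        (≤-reflexive (sym (trans (cong length (∷-injectiveʳ eq)) (length-++ (rise (suc (suc lo)) k)))))) len
    ... | A , d , refl = suc lo + k ∷ A ,
      (s≤s (m≤m+n lo k) , proj₂ (rise-top (suc lo) k (All.++⁻ˡ (rise (suc lo) (suc k)) (subst (All _) eq bs))) , d) ,
      trans eq (cong (λ m → rise (suc lo) m ++ wDown (suc lo + k) A)
        (sym (trans (cong (_∸ lo) (sym (+-suc lo k))) (m+n∸m≡n lo (suc k)))))

  -- A word that starts with its largest letter is as a whole a downward arm from `q + 1`, and an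
  -- arm is determined by its permutation.
  starts-top-unique : ∀ {q u v} → Red u → Red v → Linked Adj u → Linked Adj v → All (_≤ q) u → All (_≤ q) v →
                      Starts q u → Starts q v → (∀ x → ev u x ≡ ev v x) → u ≡ v
  starts-top-unique {q} {u} {v} ru rv lu lv bu bv (_ , refl) (_ , refl) eq
    with arm-down {lo = 0} _ u ≤-refl lu ru (All.map (λ p → z≤n , s≤s p) bu) (more refl)
       | arm-down {lo = 0} _ v ≤-refl lv rv (All.map (λ p → z≤n , s≤s p) bv) (more refl)
  ... | A , a , eqA | B , b , eqB = trans eqA (trans (cong (wDown (suc q)) A≡B) (sym eqB))
    where
    A≡B : A ≡ B
    A≡B = Down-unique A B a b λ x → begin
      jumps (suc q) A x                     ≡⟨ ev-wDown A a x ⟨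
      ev (reverse (wDown (suc q) A)) x      ≡⟨ cong (λ w → ev (reverse w) x) eqA ⟨
      ev (reverse u) x                      ≡⟨ reverse-≗ u v eq x ⟩
      ev (reverse v) x                      ≡⟨ cong (λ w → ev (reverse w) x) eqB ⟩
      ev (reverse (wDown (suc q) B)) x      ≡⟨ ev-wDown B b x ⟩
      jumps (suc q) B x                     ∎
      where open ≡-Reasoning

  -- An upward arm from `lo` starts with the letter `lo + 1`. So the word is an arm from the
  -- position before its smallest letter, and this is where letters have to be positive.
  starts-bottom-unique : ∀ {p q u v} → 0 < p → Red u → Red v → Linked Adj u → Linked Adj v →
                         All (λ i → p ≤ i × i ≤ q) u → All (λ i → p ≤ i × i ≤ q) v →
                         Starts p u → Starts p v → (∀ x → ev u x ≡ ev v x) → u ≡ v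
  starts-bottom-unique {suc p} {q} {u} {v} _ ru rv lu lv bu bv (_ , refl) (_ , refl) eq
    with arm-up _ u ≤-refl lu ru bu more | arm-up _ v ≤-refl lv rv bv more
  ... | A , a , eqA | B , b , eqB = trans eqA (trans (cong (wUp p) A≡B) (sym eqB))
    where
    open ≡-Reasoning
    -- `ev-wUp` evaluates the letters lowered by one; conjugation by `suc` raises them again.
    shift : ∀ A → Up p q A → ∀ x → suc (jumps p A x) ≡ ev (reverse (wUp p A)) (suc x)
    shift A a x = begin
      suc (jumps p A x)                                     ≡⟨ cong suc (ev-wUp A a x) ⟨
      suc (ev (reverse (map pred (wUp p A))) x)             ≡⟨ ev-conj {w = reverse (map pred (wUp p A))} {R = λ _ → ⊤} suc-injective (λ _ → refl , refl) (All.tabulate _) x ⟨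
      ev (map suc (reverse (map pred (wUp p A)))) (suc x)   ≡⟨ cong (λ w → ev w (suc x)) (reverse-map suc (map pred (wUp p A))) ⟩
      ev (reverse (map suc (map pred (wUp p A)))) (suc x)   ≡⟨ cong (λ w → ev (reverse w) (suc x)) (map-suc-pred _ (All.map proj₁ (wUp-bounds A a))) ⟩
      ev (reverse (wUp p A)) (suc x)                        ∎
    A≡B : A ≡ B
    A≡B = Up-unique A B a b λ x → suc-injective (begin
      suc (jumps p A x)                 ≡⟨ shift A a x ⟩
      ev (reverse (wUp p A)) (suc x)    ≡⟨ cong (λ w → ev (reverse w) (suc x)) eqA ⟨
      ev (reverse u) (suc x)            ≡⟨ reverse-≗ u v eq (suc x) ⟩
      ev (reverse v) (suc x)            ≡⟨ cong (λ w → ev (reverse w) (suc x)) eqB ⟩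
      ev (reverse (wUp p B)) (suc x)    ≡⟨ shift B b x ⟨
      suc (jumps p B x)                 ∎)

module Shapes (L : Pred ℕ 0ℓ) where

  open Reduced L
  open Words L

  strict : ∀ {p q w} → All (λ i → p ≤ i × i ≤ q) w → All (λ i → i ≢ p × i ≢ q) w → All (λ i → p < i × i < q) w
  strict bs ns = All.zipWith (λ ((p≤i , i≤q) , (i≢p , i≢q)) → ≤∧≢⇒< p≤i (i≢p ∘ sym) , ≤∧≢⇒< i≤q i≢q) (bs , ns)

  ev₃ : ∀ u v w x → ev (u ++ v ++ w) x ≡ ev u (ev v (ev w x))
  ev₃ u v w x = trans (ev-++ u (v ++ w) x) (cong (ev u) (ev-++ v w x))

  ev₄ : ∀ u v w t x → ev (u ++ v ++ w ++ t) x ≡ ev u (ev v (ev w (ev t x)))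
  ev₄ u v w t x = trans (ev-++ u (v ++ w ++ t) x) (cong (ev u) (ev₃ v w t x))

  -- The word  U (p … q … p) V  with both U and V nonempty: p + 1 is adjacent to
  -- the middle part on both sides, which as the transposition (p  q+1) commutes
  -- with it.

  no-double-valley : ∀ {p q} k m t u → p + k ≡ q → p + suc m ≡ q → suc p < q →
                     Red ((u ++ [ suc p ]) ++ rise p (suc k) ++ fall p (suc m) ++ suc p ∷ t) → ⊥
  no-double-valley {p} {q} k m t u kq mq p+1<q red = red-ascent P (subst Red (sym (assoc t)) red′) descent
    where
    P = [ suc p ] ++ rise p (suc k) ++ fall p (suc m)
    red′ : Red ([ suc p ] ++ rise p (suc k) ++ fall p (suc m) ++ suc p ∷ t)
    red′ = red-++ʳ u (subst Red (++-assoc u [ suc p ] _) red)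
    assoc : ∀ t → P ++ suc p ∷ t ≡ [ suc p ] ++ rise p (suc k) ++ fall p (suc m) ++ suc p ∷ t
    assoc t = cong (suc p ∷_) (++-assoc (rise p (suc k)) (fall p (suc m)) (suc p ∷ t))
    run : ∀ x → ev P x ≡ sw (suc p) (jump (suc q) p (jump p q x))
    run x = trans (ev₃ [ suc p ] (rise p (suc k)) (fall p (suc m)) x)
      (cong (sw (suc p)) (trans (ev-rise p (suc k) _)
        (cong₂ (λ a b → jump a p b) (trans (+-suc p k) (cong suc kq))
          (trans (ev-fall p (suc m) x) (cong (λ a → jump p a x) mq)))))
    p<q = <-trans (n<1+n p) p+1<q
    at₁ : ev P (suc p) ≡ suc (suc p)
    at₁ = trans (run _) (trans (cong (sw (suc p) ∘ jump (suc q) p) (jump-up ≤-refl p<q))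
      (trans (cong (sw (suc p)) (jump-down ≤-refl (m<n⇒m<1+n p<q))) (jump-at (suc p) _)))
    at₂ : ev P (suc (suc p)) ≡ suc p
    at₂ = trans (run _) (trans (cong (sw (suc p) ∘ jump (suc q) p) (jump-up (n≤1+n p) p+1<q))
      (trans (cong (sw (suc p)) (jump-down (n≤1+n p) (m<n⇒m<1+n p+1<q))) (sw-suc (suc p))))
    descent : ev P (suc (suc p)) < ev P (suc p)
    descent = subst₂ _<_ (sym at₂) (sym at₁) ≤-refl

  -- Here `i` is `q - 1`. The middle part (q ... p ... q) is again the transposition (p q+1), with
  -- which the letter `i` commutes because `p < i`.
  no-double-peak : ∀ {p i} k m t u → p + k ≡ suc i → suc p + m ≡ suc i → p < i →
                   Red ((u ++ [ i ]) ++ fall p (suc k) ++ rise (suc p) (suc m) ++ i ∷ t) → ⊥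
  no-double-peak {p} {i} k m t u kq mq p<i red = red-ascent P (subst Red (sym (assoc t)) red′) descent
    where
    P = [ i ] ++ fall p (suc k) ++ rise (suc p) (suc m)
    red′ : Red ([ i ] ++ fall p (suc k) ++ rise (suc p) (suc m) ++ i ∷ t)
    red′ = red-++ʳ u (subst Red (++-assoc u [ i ] _) red)
    assoc : ∀ t → P ++ i ∷ t ≡ [ i ] ++ fall p (suc k) ++ rise (suc p) (suc m) ++ i ∷ t
    assoc t = cong (i ∷_) (++-assoc (fall p (suc k)) (rise (suc p) (suc m)) (i ∷ t))
    run : ∀ x → ev P x ≡ sw i (jump p (suc (suc i)) (jump (suc (suc i)) (suc p) x))
    run x = trans (ev₃ [ i ] (fall p (suc k)) (rise (suc p) (suc m)) x)
      (cong (sw i) (trans (ev-fall p (suc k) _)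
        (cong₂ (λ a b → jump p a b) (trans (+-suc p k) (cong suc kq))
          (trans (ev-rise (suc p) (suc m) x) (cong (λ a → jump a (suc p) x) (trans (+-suc (suc p) m) (cong suc mq)))))))
    at₁ : ev P i ≡ suc i
    at₁ = trans (run _) (trans (cong (sw i ∘ jump p _) (jump-down p<i (m<n⇒m<1+n (n<1+n i))))
      (trans (cong (sw i) (jump-up (<⇒≤ p<i) (m<n⇒m<1+n (n<1+n i)))) (jump-at i _)))
    at₂ : ev P (suc i) ≡ i
    at₂ = trans (run _) (trans (cong (sw i ∘ jump p _) (jump-down (m<n⇒m<1+n p<i) ≤-refl))
      (trans (cong (sw i) (jump-up (<⇒≤ (m<n⇒m<1+n p<i)) ≤-refl)) (sw-suc i)))
    descent : ev P (suc i) < ev P i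
    descent = subst₂ _<_ (sym at₂) (sym at₁) ≤-refl

  -- The rest of the word stays below the top of the rise from the first `p`, so this top is `q`.
  -- After it the word either stays above `p`, and is ascending, or falls back to `p`; then (p ... q
  -- ... p) is a transposition that can be continued on one side only.
  shape-bottom-first : ∀ {p q} u v → Linked Adj (u ++ p ∷ v) → Red (u ++ p ∷ v) →
                       All (λ i → p ≤ i × i ≤ q) (p ∷ v) → All (λ i → p < i × i < q) u → q ∈ u ++ p ∷ v →
                       Shape p q (u ++ p ∷ v)
  shape-bottom-first {p} {q} u v adj red bs us q∈
    with run-up p v (linked-++ʳ u adj) (red-++ʳ u red) (All.map proj₁ (All.tail bs))
  ... | k , t , eq , bel , adjₜ , ts = cases t eqᵤ bel adjₜ ts
    where
    eqᵤ : u ++ p ∷ v ≡ u ++ rise p (suc k) ++ t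
    eqᵤ = cong (u ++_) eq

    top : p + k ≡ q
    top = ≤-antisym
      (proj₂ (rise-top p k (All.++⁻ˡ (rise p (suc k)) (subst (All _) eq bs))))
      (q≤ (Any.++⁻ u (subst (q ∈_) eqᵤ q∈)))
      where
      q≤ : q ∈ u ⊎ q ∈ rise p (suc k) ++ t → q ≤ p + k
      q≤ (inj₁ q∈u) = contradiction (proj₂ (All.lookup us q∈u)) (<-irrefl refl)
      q≤ (inj₂ q∈r) with Any.++⁻ (rise p (suc k)) q∈r
      ... | inj₁ q∈r = ≤-pred (≤-trans (proj₂ (All.lookup (rise-bounds p (suc k)) q∈r)) (≤-reflexive (+-suc p k)))
      ... | inj₂ q∈t = <⇒≤ (proj₂ (All.lookup ts q∈t))

    before : From (suc p) (reverse u)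
    before = from-adj (linked-before u adj) (All-reverse (All.map proj₁ us))

    cases : ∀ t → u ++ p ∷ v ≡ u ++ rise p (suc k) ++ t → Below (p + k) t → Linked Adj t →
            All (λ j → p ≤ j × j < p + k) t → Shape p q (u ++ p ∷ v)
    cases [] eq bel adjₜ ts = ascending record
      { k = k ; top = top ; pre = u ; post = [] ; word = eq ; pre-in = us ; post-in = []
      ; pre-from = before ; post-from = [] }
    cases (i ∷ t) eq (more i<top) adjₜ ts
      with run-down i t adjₜ (red-++ʳ (rise p (suc k)) (red-++ʳ u (subst Red eq red)))
             (All.map (λ (_ , j<) → ≤-pred (≤-trans j< (≤-reflexive (sym i<top)))) (All.tail ts))
    ... | e , m , r , refl , eqₜ , from , adjᵣ , rs
      with m≤n⇒m<n∨m≡n (proj₁ (fall-bottom e m (All.++⁻ˡ (fall e (suc m)) (subst (All _) eqₜ ts))))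
    ...   | inj₁ p<e = ascending record
      { k = k ; top = top ; pre = u ; post = i ∷ t ; word = eq ; pre-in = us
      ; post-in = subst (All _) (sym eqₜ) (All.++⁺
          (All.map (λ (e≤j , j<) → <-≤-trans p<e e≤j ,
            <-≤-trans j< (≤-reflexive (trans (+-suc e m) (trans i<top top)))) (fall-bounds e (suc m)))
          (All.map (λ (e<j , j≤) → <-trans p<e e<j ,
            ≤-<-trans j≤ (≤-reflexive (trans i<top top))) rs))
      ; pre-from = before ; post-from = more (trans i<top top) }
    -- The rise and the fall together exchange `p` and `q + 1`, and the letters before and after
    -- them fix both points.
    ...   | inj₂ refl = extremal (swap₁ , swap₂) (ends u r refl refl from)
      where
      top′ : p + suc m ≡ q
      top′ = trans (+-suc p m) (trans i<top top)
      word : u ++ p ∷ v ≡ u ++ rise p (suc k) ++ fall p (suc m) ++ r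
      word = trans eq (cong (λ t → u ++ rise p (suc k) ++ t) eqₜ)
      p<q : p < q
      p<q = subst (p <_) top′ (≤-trans (s≤s (m≤m+n p m)) (≤-reflexive (sym (+-suc p m))))
      run : ∀ x → ev (u ++ p ∷ v) x ≡ ev u (jump (suc q) p (jump p q (ev r x)))
      run x = trans (cong (λ w → ev w x) word) (trans (ev₄ u (rise p (suc k)) (fall p (suc m)) r x)
        (cong (ev u) (trans (ev-rise p (suc k) _) (cong₂ (λ a b → jump a p b) (trans (+-suc p k) (cong suc top))
          (trans (ev-fall p (suc m) _) (cong (λ a → jump p a (ev r x)) top′))))))
      swap₁ : ev (u ++ p ∷ v) (suc q) ≡ p
      swap₁ = trans (run _) (trans
        (cong (ev u ∘ jump (suc q) p ∘ jump p q)
          (ev-fixes-> (All.map (λ (_ , j≤) → s≤s (≤-<-trans j≤ (≤-reflexive (trans i<top top)))) rs)))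
        (trans (cong (ev u ∘ jump (suc q) p) (jump-> (m<n⇒m<1+n p<q) ≤-refl))
          (trans (cong (ev u) (jump-at (suc q) p)) (ev-fixes-< (All.map proj₁ us)))))
      swap₂ : ev (u ++ p ∷ v) p ≡ suc q
      swap₂ = trans (run _) (trans
        (cong (ev u ∘ jump (suc q) p ∘ jump p q) (ev-fixes-< (All.map proj₁ rs)))
        (trans (cong (ev u ∘ jump (suc q) p) (jump-at p q))
          (trans (cong (ev u) (jump-down (<⇒≤ p<q) ≤-refl)) (ev-fixes-> (All.map (s≤s ∘ proj₂) us)))))
      ends : ∀ u₀ r₀ → u₀ ≡ u → r₀ ≡ r → From (suc p) r₀ →
             (Starts p (u ++ p ∷ v) ⊎ Starts q (u ++ p ∷ v)) ⊎
             (Starts p (reverse (u ++ p ∷ v)) ⊎ Starts q (reverse (u ++ p ∷ v)))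
      ends []      r₀ refl refl _ = inj₁ (inj₁ (v , refl))
      ends (i ∷ u₀) [] refl refl _ = inj₂ (inj₁ (_ , (begin
        reverse (u ++ p ∷ v)                                              ≡⟨ cong reverse word ⟩
        reverse (u ++ rise p (suc k) ++ fall p (suc m) ++ [])             ≡⟨ cong (λ z → reverse (u ++ rise p (suc k) ++ z)) (++-identityʳ _) ⟩
        reverse (u ++ rise p (suc k) ++ fall p (suc m))                   ≡⟨ cong reverse (++-assoc u _ _) ⟨
        reverse ((u ++ rise p (suc k)) ++ fall p (suc m))                 ≡⟨ reverse-++ (u ++ rise p (suc k)) _ ⟩
        reverse (fall p (suc m)) ++ reverse (u ++ rise p (suc k))         ≡⟨ cong (_++ reverse (u ++ rise p (suc k))) (reverse-fall p (suc m)) ⟩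
        p ∷ rise (suc p) m ++ reverse (u ++ rise p (suc k))               ∎)))
        where open ≡-Reasoning
      ends (i ∷ u₀) (_ ∷ r₀) refl refl more with reverse u in req | before
      ... | .(suc p) ∷ z | more = ⊥-elim (no-double-valley k m r₀ (reverse z) top top′
        (≤-<-trans (proj₁ (All.head us)) (proj₂ (All.head us)))
        (subst Red (trans word (cong (_++ rise p (suc k) ++ fall p (suc m) ++ suc p ∷ r₀) (reverse-∷⁻ {w = u} req))) red))
      ... | [] | _ with reverse⁻ {w = u} req
      ...   | ()

  shape-top-first : ∀ {p q} u v → Linked Adj (u ++ q ∷ v) → Red (u ++ q ∷ v) →
                    All (λ i → p ≤ i × i ≤ q) (q ∷ v) → All (λ i → p < i × i < q) u → p ∈ u ++ q ∷ v →
                    Shape p q (u ++ q ∷ v)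
  shape-top-first {p} {q} u v adj red bs us p∈
    with run-down q v (linked-++ʳ u adj) (red-++ʳ u red) (All.map proj₂ (All.tail bs))
  ... | e , k , t , top , eq , from , adjₜ , ts = at-bottom bottom
    where
    bottom : e ≡ p
    bottom = ≤-antisym (e≤ (Any.++⁻ u (subst (p ∈_) (cong (u ++_) eq) p∈)))
      (proj₁ (fall-bottom e k (All.++⁻ˡ (fall e (suc k)) (subst (All _) eq bs))))
      where
      e≤ : p ∈ u ⊎ p ∈ fall e (suc k) ++ t → e ≤ p
      e≤ (inj₁ p∈u) = contradiction (proj₁ (All.lookup us p∈u)) (<-irrefl refl)
      e≤ (inj₂ p∈r) with Any.++⁻ (fall e (suc k)) p∈r
      ... | inj₁ p∈f = proj₁ (All.lookup (fall-bounds e (suc k)) p∈f)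
      ... | inj₂ p∈t = <⇒≤ (proj₁ (All.lookup ts p∈t))

    before : Below q (reverse u)
    before = below-adj (linked-before u adj) (All-reverse (All.map proj₂ us))

    reversed : ∀ t → u ++ q ∷ v ≡ u ++ fall p (suc k) ++ t →
               reverse (u ++ q ∷ v) ≡ reverse t ++ rise p (suc k) ++ reverse u
    reversed t eq = trans (cong reverse eq) (trans (reverse-++ u (fall p (suc k) ++ t))
      (trans (cong (_++ reverse u) (trans (reverse-++ (fall p (suc k)) t)
        (cong (reverse t ++_) (reverse-fall p (suc k))))) (++-assoc (reverse t) (rise p (suc k)) (reverse u))))

    descends : ∀ t → p + k ≡ q → u ++ q ∷ v ≡ u ++ fall p (suc k) ++ t → From (suc p) t →
               All (λ j → p < j × j < q) t → Shape p q (u ++ q ∷ v)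
    descends t top eq from ts = descending record
      { k = k ; top = top ; pre = reverse t ; post = reverse u ; word = reversed t eq
      ; pre-in = All-reverse ts ; post-in = All-reverse us
      ; pre-from = subst (From (suc p)) (sym (reverse-involutive t)) from ; post-from = before }

    cases : ∀ t → p + k ≡ q → u ++ q ∷ v ≡ u ++ fall p (suc k) ++ t → From (suc p) t → Linked Adj t →
            All (λ j → p < j × j ≤ q) t → Shape p q (u ++ q ∷ v)
    cases [] top eq _ _ _ = descends [] top eq [] []
    cases (_ ∷ t) top eq more adjₜ ts
      with run-up (suc p) t adjₜ (red-++ʳ (fall p (suc k)) (red-++ʳ u (subst Red eq red))) (All.map proj₁ (All.tail ts))
    ... | m , r , eqₜ , bel , adjᵣ , rs
      with m≤n⇒m<n∨m≡n (proj₂ (rise-top (suc p) m (All.++⁻ˡ (rise (suc p) (suc m)) (subst (All _) eqₜ ts))))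
    ...   | inj₁ g<q = descends (suc p ∷ t) top eq more (subst (All _) (sym eqₜ) (All.++⁺
        (All.map (λ (p<j , j<) → p<j , <-≤-trans j< (≤-trans (≤-reflexive (+-suc (suc p) m)) g<q)) (rise-bounds (suc p) (suc m)))
        (All.map (λ (p<j , j<g) → p<j , <-trans j<g g<q) rs)))
    ...   | inj₂ g≡q = extremal (swap₁ , swap₂) (ends u r refl refl (subst (λ g → Below g r) g≡q bel))
      where
      word : u ++ q ∷ v ≡ u ++ fall p (suc k) ++ rise (suc p) (suc m) ++ r
      word = trans eq (cong (λ t → u ++ fall p (suc k) ++ t) eqₜ)
      p<q : p < q
      p<q = subst (p <_) g≡q (s≤s (m≤m+n p m))
      run : ∀ x → ev (u ++ q ∷ v) x ≡ ev u (jump p (suc q) (jump (suc q) (suc p) (ev r x)))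
      run x = trans (cong (λ w → ev w x) word) (trans (ev₄ u (fall p (suc k)) (rise (suc p) (suc m)) r x)
        (cong (ev u) (trans (ev-fall p (suc k) _) (cong₂ (λ a b → jump p a b) (trans (+-suc p k) (cong suc top))
          (trans (ev-rise (suc p) (suc m) _) (cong (λ a → jump a (suc p) (ev r x)) (trans (+-suc (suc p) m) (cong suc g≡q))))))))
      swap₁ : ev (u ++ q ∷ v) (suc q) ≡ p
      swap₁ = trans (run _) (trans
        (cong (ev u ∘ jump p (suc q) ∘ jump (suc q) (suc p))
          (ev-fixes-> (All.map (λ (_ , j<) → s≤s (<-≤-trans j< (≤-reflexive g≡q))) rs)))
        (trans (cong (ev u ∘ jump p (suc q)) (jump-at (suc q) (suc p)))
          (trans (cong (ev u) (jump-up ≤-refl (m<n⇒m<1+n p<q))) (ev-fixes-< (All.map proj₁ us)))))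
      swap₂ : ev (u ++ q ∷ v) p ≡ suc q
      swap₂ = trans (run _) (trans
        (cong (ev u ∘ jump p (suc q) ∘ jump (suc q) (suc p)) (ev-fixes-< (All.map proj₁ rs)))
        (trans (cong (ev u ∘ jump p (suc q)) (jump-< (m<n⇒m<1+n p<q) ≤-refl))
          (trans (cong (ev u) (jump-at p (suc q))) (ev-fixes-> (All.map (s≤s ∘ proj₂) us)))))
      ends : ∀ u₀ r₀ → u₀ ≡ u → r₀ ≡ r → Below q r₀ →
             (Starts p (u ++ q ∷ v) ⊎ Starts q (u ++ q ∷ v)) ⊎
             (Starts p (reverse (u ++ q ∷ v)) ⊎ Starts q (reverse (u ++ q ∷ v)))
      ends []      r₀ refl refl _ = inj₁ (inj₂ (v , refl))
      ends (i ∷ u₀) [] refl refl _ = inj₂ (inj₂ (_ , (begin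
        reverse (u ++ q ∷ v)                                              ≡⟨ cong reverse word ⟩
        reverse (u ++ fall p (suc k) ++ rise (suc p) (suc m) ++ [])       ≡⟨ cong (λ z → reverse (u ++ fall p (suc k) ++ z)) (++-identityʳ _) ⟩
        reverse (u ++ fall p (suc k) ++ rise (suc p) (suc m))             ≡⟨ cong reverse (++-assoc u _ _) ⟨
        reverse ((u ++ fall p (suc k)) ++ rise (suc p) (suc m))           ≡⟨ reverse-++ (u ++ fall p (suc k)) _ ⟩
        reverse (rise (suc p) (suc m)) ++ reverse (u ++ fall p (suc k))   ≡⟨ cong (_++ reverse (u ++ fall p (suc k))) (reverse-rise (suc p) (suc m)) ⟩
        suc p + m ∷ fall (suc p) m ++ reverse (u ++ fall p (suc k))       ≡⟨ cong (_∷ _) g≡q ⟩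
        q ∷ fall (suc p) m ++ reverse (u ++ fall p (suc k))               ∎)))
        where open ≡-Reasoning
      ends (_ ∷ u₀) (i ∷ r₀) refl refl (more refl) with reverse u in req | before
      ... | .i ∷ z | more refl = ⊥-elim (no-double-peak k m r₀ (reverse z) top g≡q
        (proj₁ (All.lookup us (subst (i ∈_) (sym (reverse-∷⁻ {w = u} req)) (Any.++⁺ʳ (reverse z) (here refl)))))
        (subst Red (trans word (cong (_++ fall p (suc k) ++ rise (suc p) (suc m) ++ i ∷ r₀) (reverse-∷⁻ {w = u} req))) red))
      ... | [] | _ with reverse⁻ {w = u} req
      ...   | ()

    at-bottom : e ≡ p → Shape p q (u ++ q ∷ v)
    at-bottom refl = cases t (sym top) (cong (u ++_) eq) from adjₜ ts

  shape : ∀ i w → Linked Adj (i ∷ w) → Red (i ∷ w) →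
          ∃[ p ] ∃[ q ] All (λ j → p ≤ j × j ≤ q) (i ∷ w) × p ∈ i ∷ w × Shape p q (i ∷ w)
  shape i w adj red with extremes i w
  ... | p , q , bs , p∈ , q∈ with firstOf p q (i ∷ w) p∈
  ... | u , x , v , eq , x≡ , ns = p , q , bs , p∈ , subst (Shape p q) (sym eq) (go x≡)
    where
    us = strict (All.++⁻ˡ u (subst (All _) eq bs)) ns
    go : x ≡ p ⊎ x ≡ q → Shape p q (u ++ x ∷ v)
    go (inj₁ refl) = shape-bottom-first u v (subst (Linked Adj) eq adj) (subst Red eq red)
                       (All.++⁻ʳ u (subst (All _) eq bs)) us (subst (q ∈_) eq q∈)
    go (inj₂ refl) = shape-top-first u v (subst (Linked Adj) eq adj) (subst Red eq red)
                       (All.++⁻ʳ u (subst (All _) eq bs)) us (subst (p ∈_) eq p∈)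

-- Ascending words as pairs of arms

module _ {p q : ℕ} (p≤q : p ≤ q) where

  private c = jump (suc q) p

  c-mono : ∀ {x y} → x < y → y ≤ q → c x < c y
  c-mono x<y y≤q = jump-mono-< (suc q) p x<y (<⇒≢ (<-trans x<y (s≤s y≤q))) (<⇒≢ (s≤s y≤q))

  code-word : List ℕ × List ℕ → List ℕ
  code-word (B , A) = reverse (wUp p A) ++ rise p (suc (q ∸ p)) ++ wDown q B

  -- The letters of the left arm lie in `p + 1 … q`. Carried past the middle rise, whose value is
  -- `c`, they drop by one, which is the shift that `ev-wUp` evaluates. Both arms then act on the
  -- positions to the right of the rise.
  ev-reverse-wUp : ∀ A → Up p q A → ∀ x → ev (reverse (wUp p A)) (c x) ≡ c (jumps p A x)
  ev-reverse-wUp A a x = begin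
    ev (reverse (wUp p A)) (c x)   ≡⟨ cong (λ w → ev w (c x)) shift ⟨
    ev (map suc W) (c x)           ≡⟨ ev-conj (jump-injective (suc q) p) shifts bounds x ⟩
    c (ev W x)                     ≡⟨ cong c (ev-wUp A a x) ⟩
    c (jumps p A x)                ∎
    where
    open ≡-Reasoning
    W = reverse (map pred (wUp p A))
    shift : map suc W ≡ reverse (wUp p A)
    shift = trans (reverse-map suc (map pred (wUp p A)))
              (cong reverse (map-suc-pred (wUp p A) (All.map proj₁ (wUp-bounds A a))))
    bounds : All (λ i → p ≤ i × suc i ≤ q) W
    bounds = All-reverse (All.map⁺ (All.map (λ { {suc i} (s≤s b , t) → b , t }) (wUp-bounds A a)))
    shifts : ∀ {i} → p ≤ i × suc i ≤ q → c i ≡ suc i × c (suc i) ≡ suc (suc i)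
    shifts (b , t) = jump-down b (m<n⇒m<1+n t) , jump-down (m≤n⇒m≤1+n b) (s≤s t)

  ev-rise-pq : ∀ x → ev (rise p (suc (q ∸ p))) x ≡ c x
  ev-rise-pq x = trans (ev-rise p (suc (q ∸ p)) x)
    (cong (λ h → jump h p x) (trans (+-suc p (q ∸ p)) (cong suc (m+[n∸m]≡n p≤q))))

  ev-code-word : ∀ A B → Up p q A → Down p q B → ∀ x → ev (code-word (B , A)) (jumps q B x) ≡ c (jumps p A x)
  ev-code-word A B a b x = begin
    ev (code-word (B , A)) (jumps q B x)
      ≡⟨ trans (ev-++ (reverse (wUp p A)) _ _) (cong (ev (reverse (wUp p A))) (ev-++ (rise p (suc (q ∸ p))) (wDown q B) _)) ⟩
    ev (reverse (wUp p A)) (ev (rise p (suc (q ∸ p))) (ev (wDown q B) (jumps q B x)))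
      ≡⟨ cong (λ y → ev (reverse (wUp p A)) (ev (rise p (suc (q ∸ p))) (ev (wDown q B) y))) (ev-wDown B b x) ⟨
    ev (reverse (wUp p A)) (ev (rise p (suc (q ∸ p))) (ev (wDown q B) (ev (reverse (wDown q B)) x)))
      ≡⟨ cong (ev (reverse (wUp p A)) ∘ ev (rise p (suc (q ∸ p)))) (ev-reverseʳ (wDown q B) x) ⟩
    ev (reverse (wUp p A)) (ev (rise p (suc (q ∸ p))) x)
      ≡⟨ cong (ev (reverse (wUp p A))) (ev-rise-pq x) ⟩
    ev (reverse (wUp p A)) (c x)
      ≡⟨ ev-reverse-wUp A a x ⟩
    c (jumps p A x)
      ∎
    where open ≡-Reasoning

  module _ (L : Pred ℕ 0ℓ) where

    open Reduced L
    open Words L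

    codes-NoDouble : ∀ A B → Up p q A → Down p q B → Red (code-word (B , A)) → NoDouble (jumps q B) (jumps p A)
    codes-NoDouble A B a b red {x} {y} x<y invB invA =
      red-NoDouble (reverse (wUp p A)) (rise p (suc (q ∸ p)) ++ wDown q B) red (c-mono x<y y≤q)
        (subst₂ _<_ (sym (ev-reverse-wUp A a y)) (sym (ev-reverse-wUp A a x)) (c-mono invA gx≤q))
        (subst₂ _<_ (sym (right y)) (sym (right x)) invB)
      where
      -- `c` is known to preserve the order only up to `q`. The left arm fixes everything above, so
      -- none of the pairs that it crosses reaches there.
      y≤q : y ≤ q
      y≤q = ≮⇒≥ λ q<y →
        let y<gx = subst (_< jumps p A x) (Up-fixes-> A a q<y) invA
        in <-asym x<y (subst (y <_) (jumps-injective p A (Up-fixes-> A a (<-trans q<y y<gx))) y<gx)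
      gx≤q : jumps p A x ≤ q
      gx≤q = fixes-≤ (jumps-injective p A) (Up-fixes-> A a) (<⇒≤ (<-≤-trans x<y y≤q))
      right : ∀ z → ev (reverse (rise p (suc (q ∸ p)) ++ wDown q B)) (c z) ≡ jumps q B z
      right z = begin
        ev (reverse (rise p k ++ wDown q B)) (c z)
          ≡⟨ cong (λ w → ev w (c z)) (reverse-++ (rise p k) (wDown q B)) ⟩
        ev (reverse (wDown q B) ++ reverse (rise p k)) (c z)
          ≡⟨ ev-++ (reverse (wDown q B)) _ _ ⟩
        ev (reverse (wDown q B)) (ev (reverse (rise p k)) (c z))
          ≡⟨ cong (ev (reverse (wDown q B)) ∘ ev (reverse (rise p k))) (ev-rise-pq z) ⟨
        ev (reverse (wDown q B)) (ev (reverse (rise p k)) (ev (rise p k) z))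
          ≡⟨ cong (ev (reverse (wDown q B))) (ev-reverse (rise p k) z) ⟩
        ev (reverse (wDown q B)) z
          ≡⟨ ev-wDown B b z ⟩
        jumps q B z
          ∎
        where
        open ≡-Reasoning
        k = suc (q ∸ p)

    -- In `σ = U (p … q) V` the middle is known, so it is absorbed into the map that relates the two
    -- arms.
    ascending-solution : ∀ {σ σ⁻ w} → (∀ x → σ⁻ (σ x) ≡ x) → Realises σ w → Ascends p q w →
                         ∃[ s ] Solution p q p q (σ⁻ ∘ jump (suc q) p) (jump p (suc q) ∘ σ) s × w ≡ code-word s
    ascending-solution {σ} {σ⁻} {w} inv (red , adj , eqσ)
      record { k = k ; top = top ; pre = u ; post = v ; word = word ; pre-in = us ; post-in = vs
             ; pre-from = from ; post-from = below }
      with arm-up {lo = p} {hi = q} _ (reverse u) ≤-refl (linked-reverse u (linked-++ˡ u (subst (Linked Adj) word adj)))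
             (red-reverse (red-++ˡ u (subst Red word red))) (All-reverse (All.map (λ (a , b) → a , <⇒≤ b) us)) from
         | arm-down {lo = p} _ v ≤-refl (linked-++ʳ (rise p (suc k)) (linked-++ʳ u (subst (Linked Adj) word adj)))
             (red-++ʳ (rise p (suc k)) (red-++ʳ u (subst Red word red))) (All.map (λ (a , b) → <⇒≤ a , b) vs) below
    ... | A , a , eqA | B , b , eqB = (B , A) , record
      { down = b ; up = a ; to = σ⁻-mid ; from = from′
      ; nd = codes-NoDouble A B a b (subst Red w≡ red) } , w≡
      where
      k≡ : k ≡ q ∸ p
      k≡ = sym (trans (cong (_∸ p) (sym top)) (m+n∸m≡n p k))
      w≡ : w ≡ code-word (B , A)
      w≡ = trans word (cong₂ _++_ (reverse⁻ eqA) (cong₂ (λ k v → rise p (suc k) ++ v) k≡ eqB))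
      σ-mid : ∀ x → σ (jumps q B x) ≡ jump (suc q) p (jumps p A x)
      σ-mid x = trans (sym (eqσ _)) (trans (cong (λ w → ev w (jumps q B x)) w≡) (ev-code-word A B a b x))
      σ⁻-mid : ∀ x → σ⁻ (jump (suc q) p (jumps p A x)) ≡ jumps q B x
      σ⁻-mid x = trans (cong σ⁻ (sym (σ-mid x))) (inv _)
      from′ : ∀ x → jump p (suc q) (σ (jumps q B x)) ≡ jumps p A x
      from′ x = trans (cong (jump p (suc q)) (σ-mid x)) (jump-inverse (suc q) p _)

    atMost-ascending : ∀ {σ σ⁻ : ℕ → ℕ} → (∀ x → σ⁻ (σ x) ≡ x) → AtMost 4 (λ w → Realises σ w × Ascends p q w)
    atMost-ascending {σ} {σ⁻} inv = atMost-image code-word (λ w (r , asc) → ascending-solution {σ} {σ⁻} inv r asc)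
      (atMost-4 _ ≤-refl ≤-refl ≤-refl)

  ascends-top : ∀ {w} → Ascends p q w → ev w (suc q) ≡ p
  ascends-top {w} record { k = k ; top = top ; pre = u ; post = v ; word = word ; pre-in = us ; post-in = vs } = begin
    ev w (suc q)                                  ≡⟨ cong (λ w → ev w (suc q)) word ⟩
    ev (u ++ rise p (suc k) ++ v) (suc q)         ≡⟨ trans (ev-++ u _ _) (cong (ev u) (ev-++ (rise p (suc k)) v _)) ⟩
    ev u (ev (rise p (suc k)) (ev v (suc q)))     ≡⟨ cong (ev u ∘ ev (rise p (suc k))) (ev-fixes-> (All.map (s≤s ∘ proj₂) vs)) ⟩
    ev u (ev (rise p (suc k)) (suc q))            ≡⟨ cong (ev u) (ev-rise p (suc k) (suc q)) ⟩
    ev u (jump (p + suc k) p (suc q))             ≡⟨ cong (λ h → ev u (jump h p (suc q))) (trans (+-suc p k) (cong suc top)) ⟩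
    ev u (jump (suc q) p (suc q))                 ≡⟨ cong (ev u) (jump-at (suc q) p) ⟩
    ev u p                                        ≡⟨ ev-fixes-< (All.map proj₁ us) ⟩
    p                                             ∎
    where open ≡-Reasoning

  -- If `p < q`, the suffix fixes `p`, the rise sends it to `p + 1`, and the letters of the prefix,
  -- all below `q`, cannot take it to `q + 1`.
  ascends-swap : ∀ {w} → Ascends p q w → ev w p ≡ suc q → p ≡ q
  ascends-swap {w} record { k = k ; top = top ; pre = u ; post = v ; word = word ; pre-in = us ; post-in = vs } eq
    with m≤n⇒m<n∨m≡n p≤q
  ... | inj₂ p≡q = p≡q
  ... | inj₁ p<q = contradiction (trans (sym eq) value) (>⇒≢ (s≤s (ev-≤ u (All.map proj₂ us) p<q)))
    where
    open ≡-Reasoning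
    value : ev w p ≡ ev u (suc p)
    value = begin
      ev w p                                  ≡⟨ cong (λ w → ev w p) word ⟩
      ev (u ++ rise p (suc k) ++ v) p         ≡⟨ trans (ev-++ u _ _) (cong (ev u) (ev-++ (rise p (suc k)) v _)) ⟩
      ev u (ev (rise p (suc k)) (ev v p))     ≡⟨ cong (ev u ∘ ev (rise p (suc k))) (ev-fixes-< (All.map proj₁ vs)) ⟩
      ev u (ev (rise p (suc k)) p)            ≡⟨ cong (ev u) (ev-rise p (suc k) p) ⟩
      ev u (jump (p + suc k) p p)             ≡⟨ cong (λ h → ev u (jump h p p)) (trans (+-suc p k) (cong suc top)) ⟩
      ev u (jump (suc q) p p)                 ≡⟨ cong (ev u) (jump-down ≤-refl (s≤s p≤q)) ⟩
      ev u (suc p)                            ∎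

ascends-single : ∀ {p w} → Ascends p p w → Starts p w
ascends-single record { pre = [] ; word = word } = _ , word
ascends-single record { pre = _ ∷ _ ; pre-in = (p<i , i<p) ∷ _ } = contradiction i<p (<-asym p<i)

-- Recovering the extreme letters, and the count

record Support (p q : ℕ) (σ : ℕ → ℕ) : Set where
  field
    ordered : p ≤ q
    low     : ∀ {x} → x < p → σ x ≡ x
    high    : ∀ {x} → suc q < x → σ x ≡ x
    moves   : σ (suc q) ≡ p ⊎ σ p ≡ suc q

open Support

module _ {σ : ℕ → ℕ} (inj : Injective σ) where

  -- By `moves` and injectivity `σ` moves `p`, whereas everything below `p′` is fixed.
  support-≮ : ∀ {p q p′ q′} → Support p q σ → Support p′ q′ σ → p < p′ → ⊥
  support-≮ s t p<p′ with moves s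
  ... | inj₁ eq = <⇒≢ (s≤s (ordered s)) (inj (trans (low t p<p′) (sym eq)))
  ... | inj₂ eq = <⇒≢ (s≤s (ordered s)) (trans (sym (low t p<p′)) eq)

  support-≯ : ∀ {p q p′ q′} → Support p q σ → Support p′ q′ σ → q < q′ → ⊥
  support-≯ s t q<q′ with moves t
  ... | inj₁ eq = <⇒≢ (s≤s (ordered t)) (trans (sym eq) (high s (s≤s q<q′)))
  ... | inj₂ eq = <⇒≢ (s≤s (ordered t)) (inj (trans eq (sym (high s (s≤s q<q′)))))

  support-unique : ∀ {p q p′ q′} → Support p q σ → Support p′ q′ σ → p ≡ p′ × q ≡ q′
  support-unique s t =
    ≤-antisym (≮⇒≥ (support-≮ t s)) (≮⇒≥ (support-≮ s t)) ,
    ≤-antisym (≮⇒≥ (support-≯ t s)) (≮⇒≥ (support-≯ s t))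

reverse-at : ∀ w → ev w x ≡ y → ev (reverse w) y ≡ x
reverse-at w refl = ev-reverse w _

reverse-at⁻ : ∀ w → ev (reverse w) x ≡ y → ev w y ≡ x
reverse-at⁻ w refl = ev-reverseʳ w _

module Count (L : Pred ℕ 0ℓ) (L>0 : ∀ {i} → L i → 0 < i) where

  open Reduced L
  open Words L
  open Shapes L

  Within : ℕ → ℕ → List ℕ → Set
  Within p q w = All (λ i → p ≤ i × i ≤ q) w

  record Analysed (p q : ℕ) (σ : ℕ → ℕ) (w : List ℕ) : Set where
    field
      realises : Realises σ w
      within   : Within p q w
      shaped   : Shape p q w

  shape-moves : ∀ {p q w} → p ≤ q → Shape p q w → ev w (suc q) ≡ p ⊎ ev w p ≡ suc q
  shape-moves p≤q (ascending a)           = inj₁ (ascends-top p≤q a)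
  shape-moves {w = w} p≤q (descending a)  = inj₂ (reverse-at⁻ w (ascends-top p≤q a))
  shape-moves p≤q (extremal (s , _) _)    = inj₁ s

  analyse : ∀ {σ} i w → Realises σ (i ∷ w) → ∃[ p ] ∃[ q ] 0 < p × Support p q σ × Analysed p q σ (i ∷ w)
  analyse {σ} i w r@(red , adj , eq) with shape i w adj red
  ... | p , q , bs , p∈ , sh = p , q , L>0 (All.lookup (proj₁ red) p∈) , record
    { ordered = p≤q
    ; low  = λ x<p → trans (sym (eq _)) (ev-fixes-< {w = i ∷ w} (All.map (λ (a , _) → <-≤-trans x<p a) bs))
    ; high = λ q<x → trans (sym (eq _)) (ev-fixes-> {w = i ∷ w} (All.map (λ (_ , b) → ≤-<-trans (s≤s b) q<x) bs))
    ; moves = move (shape-moves p≤q sh) } , record { realises = r ; within = bs ; shaped = sh }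
    where
    p≤q : p ≤ q
    p≤q = ≤-trans (proj₁ (All.head bs)) (proj₂ (All.head bs))
    move : ev (i ∷ w) (suc q) ≡ p ⊎ ev (i ∷ w) p ≡ suc q → σ (suc q) ≡ p ⊎ σ p ≡ suc q
    move (inj₁ e) = inj₁ (trans (sym (eq _)) e)
    move (inj₂ e) = inj₂ (trans (sym (eq _)) e)

  -- Whether `σ` sends `q + 1` to `p`, or `p` to `q + 1`, leaves a single shape to count. Descending
  -- words become ascending ones of the inverse by reversal.
  atMost-analysed : ∀ {p q σ σ⁻} → p ≤ q → 0 < p → (∀ x → σ⁻ (σ x) ≡ x) → (∀ x → σ (σ⁻ x) ≡ x) →
                    AtMost 4 (Analysed p q σ)
  atMost-analysed {p} {q} {σ} {σ⁻} p≤q 0<p invˡ invʳ with σ (suc q) ≟ p | σ p ≟ suc q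
  ... | yes top | yes bottom = atMost-∪ {k₁ = 2} {k₂ = 2} cover
        (atMost-∪ {k₁ = 1} {k₂ = 1} (λ { _ (a , inj₁ e) → inj₁ (a , e) ; _ (a , inj₂ e) → inj₂ (a , e) })
          (atMost-1 (starting bottom-unique)) (atMost-1 (starting top-unique)))
        (atMost-∪ {k₁ = 1} {k₂ = 1} (λ { _ (a , inj₁ e) → inj₁ (a , e) ; _ (a , inj₂ e) → inj₂ (a , e) })
          (atMost-1 (ending bottom-unique)) (atMost-1 (ending top-unique)))
    where
    open Analysed
    Unique-from : ℕ → Set
    Unique-from x = ∀ {u v} → Red u → Red v → Linked Adj u → Linked Adj v → Within p q u → Within p q v →
                    Starts x u → Starts x v → (∀ z → ev u z ≡ ev v z) → u ≡ v
    bottom-unique : Unique-from p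
    bottom-unique = starts-bottom-unique 0<p
    top-unique : Unique-from q
    top-unique ru rv lu lv bu bv = starts-top-unique ru rv lu lv (All.map proj₂ bu) (All.map proj₂ bv)
    starting : ∀ {x} → Unique-from x → ∀ u v → Analysed p q σ u × Starts x u → Analysed p q σ v × Starts x v → u ≡ v
    starting uniq u v (a , su) (b , sv) with realises a | realises b
    ... | ru , lu , eu | rv , lv , ev′ =
      uniq ru rv lu lv (within a) (within b) su sv (λ z → trans (eu z) (sym (ev′ z)))
    ending : ∀ {x} → Unique-from x → ∀ u v → Analysed p q σ u × Starts x (reverse u) →
             Analysed p q σ v × Starts x (reverse v) → u ≡ v
    ending uniq u v (a , su) (b , sv) with realises a | realises b
    ... | ru , lu , eu | rv , lv , ev′ = reverse-injective
      (uniq (red-reverse ru) (red-reverse rv) (linked-reverse u lu) (linked-reverse v lv)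
        (All-reverse (within a)) (All-reverse (within b)) su sv
        (reverse-≗ u v (λ z → trans (eu z) (sym (ev′ z)))))
    cover : ∀ w → Analysed p q σ w →
            (Analysed p q σ w × (Starts p w ⊎ Starts q w)) ⊎
            (Analysed p q σ w × (Starts p (reverse w) ⊎ Starts q (reverse w)))
    cover w a with realises a | shaped a
    -- When `σ` swaps `p` and `q + 1`, an ascending word has `p ≡ q` and so starts with `p`; it
    -- falls under the four cases of extremal words.
    ... | _ , _ , eq | ascending asc with ascends-swap p≤q asc (trans (eq p) bottom)
    ...   | refl = inj₁ (a , inj₁ (ascends-single asc))
    cover w a | _ , _ , eq | descending asc with ascends-swap p≤q asc (reverse-at w (trans (eq (suc q)) top))
    ...   | refl = inj₂ (a , inj₁ (ascends-single asc))
    cover w a | _ | extremal _ (inj₁ s) = inj₁ (a , s)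
    cover w a | _ | extremal _ (inj₂ s) = inj₂ (a , s)
  ... | _ | no ¬bottom = atMost-image id ascend (atMost-ascending p≤q L {σ} {σ⁻} invˡ)
    where
    open Analysed
    ascend : ∀ w → Analysed p q σ w → ∃[ v ] (Realises σ v × Ascends p q v) × w ≡ v
    ascend w a with realises a | shaped a
    ... | r , l , eq | ascending asc        = w , ((r , l , eq) , asc) , refl
    ... | r , l , eq | descending asc       = contradiction (trans (sym (eq p)) (reverse-at⁻ w (ascends-top p≤q asc))) ¬bottom
    ... | r , l , eq | extremal (_ , s) _   = contradiction (trans (sym (eq p)) s) ¬bottom
  ... | no ¬top | yes _ = atMost-image reverse descend (atMost-ascending p≤q L {σ⁻} {σ} invʳ)
    where
    open Analysed
    descend : ∀ w → Analysed p q σ w → ∃[ v ] (Realises σ⁻ v × Ascends p q v) × w ≡ reverse v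
    descend w a with realises a | shaped a
    ... | r , l , eq | ascending asc        = contradiction (trans (sym (eq (suc q))) (ascends-top p≤q asc)) ¬top
    ... | r , l , eq | extremal (s , _) _   = contradiction (trans (sym (eq (suc q))) s) ¬top
    ... | r , l , eq | descending asc       = reverse w ,
      ((red-reverse r , linked-reverse w l , λ x → begin
        ev (reverse w) x               ≡⟨ cong (ev (reverse w)) (invʳ x) ⟨
        ev (reverse w) (σ (σ⁻ x))      ≡⟨ cong (ev (reverse w)) (eq (σ⁻ x)) ⟨
        ev (reverse w) (ev w (σ⁻ x))   ≡⟨ ev-reverse w (σ⁻ x) ⟩
        σ⁻ x                           ∎) , asc) , sym (reverse-involutive w)
      where open ≡-Reasoning

  atMost-realisations : ∀ σ → AtMost 4 (Realises σ)
  atMost-realisations σ = atMost-sample sample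
    where
    same-length : ∀ {u v} → Realises σ u → Realises σ v → length u ≤ length v
    same-length ((_ , min) , _ , eq) ((ls , _) , _ , eq′) = min _ ls (λ x → trans (eq′ x) (sym (eq x)))

    sample : ∀ w → Realises σ w → AtMost 4 (Realises σ)
    sample [] r₀ = atMost-mono (s≤s z≤n) (atMost-1 λ u v r s → trans (empty u (same-length r r₀)) (sym (empty v (same-length s r₀))))
      where
      empty : ∀ (u : List ℕ) → length u ≤ 0 → u ≡ []
      empty [] _ = refl
    sample (i ∷ w) r₀@(_ , _ , eq) with analyse i w r₀
    ... | p , q , 0<p , supp , _ = atMost-image id analysed
      (atMost-analysed {σ⁻ = ev (reverse (i ∷ w))} (ordered supp) 0<p
        (λ x → trans (cong (ev (reverse (i ∷ w))) (sym (eq x))) (ev-reverse (i ∷ w) x))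
        (λ x → trans (sym (eq _)) (ev-reverseʳ (i ∷ w) x)))
      where
      σ-injective : Injective σ
      σ-injective e = ev-injective (i ∷ w) (trans (eq _) (trans e (sym (eq _))))
      analysed : ∀ v → Realises σ v → ∃[ v′ ] Analysed p q σ v′ × v ≡ v′
      analysed [] r = contradiction (same-length r₀ r) λ ()
      analysed (j ∷ v) r with analyse j v r
      ... | p′ , q′ , _ , supp′ , a with support-unique σ-injective supp supp′
      ...   | refl , refl = j ∷ v , a , refl

-- Words over Fin n

atMost-injective : ∀ {a b p q} {X : Set a} {Y : Set b} {P : Pred X p} {Q : Pred Y q} {k : ℕ} (f : X → Y) →
                   (∀ {x y} → f x ≡ f y → x ≡ y) → (∀ {x} → P x → Q (f x)) → AtMost k Q → AtMost k P
atMost-injective f inj P⇒Q most xs u ps =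
  subst (_≤ _) (length-map f xs) (most (map f xs) (Unique.map⁺ inj u) (All.map⁺ (All.map P⇒Q ps)))

-- Serves for letters and points alike. Counting from one leaves room for the position before the
-- smallest letter, from which an upward arm is coded.
letter : Fin n → ℕ
letter i = suc (toℕ i)

letter-injective : ∀ {i j : Fin n} → letter i ≡ letter j → i ≡ j
letter-injective eq = Fin.toℕ-injective (suc-injective eq)

letters : Word n → List ℕ
letters = map letter

module _ (i j : Fin n) where

  transpose-at : transpose i j ⟨$⟩ʳ i ≡ j
  transpose-at with i Fin.≟ i
  ... | yes _ = refl
  ... | no ne = contradiction refl ne

  transpose-to : transpose i j ⟨$⟩ʳ j ≡ i
  transpose-to with j Fin.≟ i
  ... | yes eq = eq
  ... | no _ with j Fin.≟ j
  ...   | yes _ = refl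
  ...   | no ne = contradiction refl ne

  transpose-off : ∀ {x} → x ≢ i → x ≢ j → transpose i j ⟨$⟩ʳ x ≡ x
  transpose-off {x} x≢i x≢j with x Fin.≟ i
  ... | yes eq = contradiction eq x≢i
  ... | no _ with x Fin.≟ j
  ...   | yes eq = contradiction eq x≢j
  ...   | no _ = refl

sw-letter : ∀ (i : Fin n) x → sw (letter i) (letter x) ≡ letter (s i ⟨$⟩ʳ x)
sw-letter i x = cases (x Fin.≟ inject₁ i) (x Fin.≟ Fin.suc i)
  where
  inject : letter (inject₁ i) ≡ letter i
  inject = cong suc (Fin.toℕ-inject₁ i)
  cases : Dec (x ≡ inject₁ i) → Dec (x ≡ Fin.suc i) → sw (letter i) (letter x) ≡ letter (s i ⟨$⟩ʳ x)
  cases (yes refl) _ = trans (cong (sw (letter i)) inject)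
    (trans (jump-at (letter i) _) (cong letter (sym (transpose-at (inject₁ i) (Fin.suc i)))))
  cases (no _) (yes refl) = trans (sw-suc (letter i))
    (trans (sym inject) (cong letter (sym (transpose-to (inject₁ i) (Fin.suc i)))))
  cases (no x≢i) (no x≢1+i) = trans (sw-off (λ e → x≢i (letter-injective (trans e (sym inject)))) (x≢1+i ∘ letter-injective))
    (cong letter (sym (transpose-off (inject₁ i) (Fin.suc i) x≢i x≢1+i)))

ev-letters : ∀ (w : Word n) x → ev (letters w) (letter x) ≡ letter (eval w ⟨$⟩ʳ x)
ev-letters []      x = refl
ev-letters (i ∷ w) x = trans (cong (sw (letter i)) (ev-letters w x)) (sw-letter i (eval w ⟨$⟩ʳ x))

-- Positions that code no point, `0` and those beyond `n + 1`, are fixed by every word.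
eval⇒ev : ∀ (u v : Word n) → eval u ≈ eval v → ∀ z → ev (letters u) z ≡ ev (letters v) z
eval⇒ev u v eq zero = trans (fixes u) (sym (fixes v))
  where
  fixes : ∀ (w : Word _) → ev (letters w) 0 ≡ 0
  fixes w = ev-fixes-< {w = letters w} (All.map⁺ (All.tabulate λ _ → s≤s z≤n))
eval⇒ev {n} u v eq (suc z) with z <? suc n
... | yes z<1+n = subst (λ x → ev (letters u) x ≡ ev (letters v) x) (cong suc (Fin.toℕ-fromℕ< z<1+n))
  (trans (ev-letters u p) (trans (cong letter (eq p)) (sym (ev-letters v p))))
  where p = fromℕ< z<1+n
... | no z≮1+n = trans (fixes u) (sym (fixes v))
  where
  fixes : ∀ (w : Word n) → ev (letters w) (suc z) ≡ suc z
  fixes w = ev-fixes-> {w = letters w} (All.map⁺ (All.tabulate λ {i} _ → s≤s (≤-trans (s≤s (Fin.toℕ<n i)) (≮⇒≥ z≮1+n))))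

ev⇒eval : ∀ (u v : Word n) → (∀ z → ev (letters u) z ≡ ev (letters v) z) → eval u ≈ eval v
ev⇒eval u v eq x = letter-injective (trans (sym (ev-letters u x)) (trans (eq (letter x)) (ev-letters v x)))

-- With the letters of competing words restricted in this way, minimality in `Red` agrees with
-- minimality in `R`.
IsLetter : ℕ → Pred ℕ 0ℓ
IsLetter n i = ∃[ j ] i ≡ letter {n} j

letters⁻ : ∀ {v} → All (IsLetter n) v → ∃[ w ] v ≡ letters {n} w
letters⁻ []               = [] , refl
letters⁻ ((j , refl) ∷ ps) with letters⁻ ps
... | w , refl = j ∷ w , refl

-- One-element commutation classes

module _ {n : ℕ} where

  open Reduced (IsLetter n)

  R⇒Red : ∀ {σ w} → R σ w → Red (letters w)
  R⇒Red {σ} {w} (w≈σ , min) = All.map⁺ (All.tabulate λ {i} _ → i , refl) , minimal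
    where
    minimal : ∀ v → All (IsLetter n) v → (∀ x → ev v x ≡ ev (letters w) x) → length (letters w) ≤ length v
    minimal v ls eq with letters⁻ ls
    ... | v′ , refl = subst₂ _≤_ (sym (length-map letter w)) (sym (length-map letter v′))
      (min v′ (λ x → trans (ev⇒eval v′ w eq x) (w≈σ x)))

  Close : Fin n → Fin n → Set
  Close i j = ∣ toℕ i - toℕ j ∣ ≤ 1

  far-≢ : ∀ {i j : Fin n} → ∣ toℕ i - toℕ j ∣ > 1 → i ≢ j
  far-≢ {i} far refl = contradiction (subst (1 <_) (∣n-n∣≡0 (toℕ i)) far) λ ()

  ⇝-length : ∀ {u v : Word n} → u ⇝ v → length u ≡ length v
  ⇝-length (here _)  = refl
  ⇝-length (there p) = cong suc (⇝-length p)

  ⇝-ev : ∀ {u v : Word n} → u ⇝ v → ∀ z → ev (letters u) z ≡ ev (letters v) z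
  ⇝-ev (there {i = i} p) z = cong (sw (letter i)) (⇝-ev p z)
  ⇝-ev (here {i} {j} {w} far) z = sw-conj (jump-injective (letter j) _)
    (sw-off (λ e → far-≢ far (letter-injective e)) λ e → far⁻ (inj₂ (suc-injective e)))
    (sw-off (λ e → far⁻ (inj₁ (sym (suc-injective e)))) λ e → far-≢ far (letter-injective (suc-injective e))) _
    where
    far⁻ : Adj (toℕ i) (toℕ j) → ⊥
    far⁻ (inj₁ e) = contradiction (subst (1 <_) (trans (cong ∣ toℕ i -_∣ e) (∣m-m+n∣≡n′ (toℕ i))) far) (<-irrefl refl)
      where
      ∣m-m+n∣≡n′ : ∀ m → ∣ m - suc m ∣ ≡ 1
      ∣m-m+n∣≡n′ zero    = refl
      ∣m-m+n∣≡n′ (suc m) = ∣m-m+n∣≡n′ m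
    far⁻ (inj₂ e) = contradiction (subst (1 <_) (trans (cong ∣_- toℕ j ∣ e) (∣1+m-m∣ (toℕ j))) far) (<-irrefl refl)
      where
      ∣1+m-m∣ : ∀ m → ∣ suc m - m ∣ ≡ 1
      ∣1+m-m∣ zero    = refl
      ∣1+m-m∣ (suc m) = ∣1+m-m∣ m

  ⇝-R : ∀ {σ} {u v : Word n} → R σ u → u ⇝ v → R σ v
  ⇝-R {u = u} {v} (u≈σ , min) p = (λ x → trans (sym (ev⇒eval u v (⇝-ev p) x)) (u≈σ x)) ,
    λ t t≈σ → ≤-trans (≤-reflexive (sym (⇝-length p))) (min t t≈σ)

  close-⇝ : ∀ {u v : Word n} → Linked Close u → u ⇝ v → ⊥
  close-⇝ (c ∷ _)       (here far) = <⇒≱ far c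
  close-⇝ (_ ∷ l)       (there p)  = close-⇝ l p
  close-⇝ [-]           (there ())

  close-⇜ : ∀ {u v : Word n} → Linked Close u → v ⇝ u → ⊥
  close-⇜ (c ∷ _) (here {i} {j} far) = <⇒≱ far (subst (_≤ 1) (∣-∣-comm (toℕ j) (toℕ i)) c)
  close-⇜ l       (there p)          = close-⇜ (Linked.tail l) p

  ¬⇝-close : ∀ (w : Word n) → (∀ {v} → w ⇝ v → w ≡ v) → Linked Close w
  ¬⇝-close []          _ = []
  ¬⇝-close (i ∷ [])    _ = [-]
  ¬⇝-close (i ∷ j ∷ w) h = ≮⇒≥ (λ far → far-≢ far (∷-injectiveˡ (h (here far)))) ∷
    ¬⇝-close (j ∷ w) (λ p → ∷-injectiveʳ (h (there p)))

  R•⇒close : ∀ {σ w} → R• σ w → Linked Close w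
  R•⇒close {σ} {w} (r , (only , _)) = ¬⇝-close w λ p → only (⇝-R {σ} r p , fwd p ◅ ε)

  -- No commutation leads out of or into such a word, so a chain of commutations in either direction
  -- has no first step.
  close⇒R• : ∀ {σ w} → R σ w → Linked Close w → R• σ w
  close⇒R• {σ} {w} r l = r , (λ (_ , c) → only c) , λ { refl → r , ε }
    where
    only : ∀ {v} → EqClosure _⇝_ w v → w ≡ v
    only ε           = refl
    only (fwd p ◅ _) = contradiction p (close-⇝ l)
    only (bwd p ◅ _) = contradiction p (close-⇜ l)

  close-adj : ∀ a b → ∣ a - b ∣ ≤ 1 → a ≢ b → Adj a b
  close-adj zero    zero          _ ne = contradiction refl ne
  close-adj zero    (suc zero)    _ _  = inj₁ refl
  close-adj zero    (suc (suc b)) (s≤s ()) _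
  close-adj (suc zero) zero       _ _  = inj₂ refl
  close-adj (suc (suc a)) zero    (s≤s ()) _
  close-adj (suc a) (suc b)       c ne with close-adj a b c (ne ∘ cong suc)
  ... | inj₁ e = inj₁ (cong suc e)
  ... | inj₂ e = inj₂ (cong suc e)

  -- `Close` still admits equal neighbours; these would cancel, which `red-ascent` rules out.
  close⇒linked : ∀ w → Linked Close w → Red (letters w) → Linked Adj (letters w)
  close⇒linked []          _       _   = []
  close⇒linked (i ∷ [])    _       _   = [-]
  close⇒linked (i ∷ j ∷ w) (c ∷ l) red =
    close-adj (letter i) (letter j) c distinct ∷ close⇒linked (j ∷ w) l (red-++ʳ [ letter i ] red)
    where
    distinct : letter i ≢ letter j
    distinct e = red-ascent [ letter i ] (subst (λ a → Red (letter i ∷ a ∷ letters w)) (sym e) red)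
      (subst₂ _<_ (sym (sw-suc (letter i))) (sym (jump-at (letter i) _)) ≤-refl)

  atMost-4-R• : ∀ σ → AtMost 4 (R• {n} σ)
  atMost-4-R• σ = atMost-sample λ w₀ ((w₀≈σ , _) , _) →
    atMost-injective letters (map-injective letter-injective)
      (λ {w} r• → let r = proj₁ r•; red = R⇒Red {σ = σ} r in red , close⇒linked w (R•⇒close {σ = σ} r•) red ,
         eval⇒ev w w₀ (λ x → trans (proj₁ r x) (sym (w₀≈σ x))))
      (Count.atMost-realisations (IsLetter n) (λ { (_ , refl) → s≤s z≤n }) (ev (letters w₀)))

-- Generation by adjacent transpositions, and enumeration

eval-++ : ∀ (u v : Word n) x → eval (u ++ v) ⟨$⟩ʳ x ≡ eval u ⟨$⟩ʳ (eval v ⟨$⟩ʳ x)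
eval-++ []      v x = refl
eval-++ (i ∷ u) v x = cong (s i ⟨$⟩ʳ_) (eval-++ u v x)

eval-reverse : ∀ (w : Word n) x → eval (reverse w) ⟨$⟩ʳ (eval w ⟨$⟩ʳ x) ≡ x
eval-reverse w x = letter-injective (begin
  letter (eval (reverse w) ⟨$⟩ʳ (eval w ⟨$⟩ʳ x))         ≡⟨ ev-letters (reverse w) _ ⟨
  ev (letters (reverse w)) (letter (eval w ⟨$⟩ʳ x))     ≡⟨ cong₂ ev (reverse-map letter w) (sym (ev-letters w x)) ⟩
  ev (reverse (letters w)) (ev (letters w) (letter x))  ≡⟨ ev-reverse (letters w) (letter x) ⟩
  letter x                                              ∎)
  where open ≡-Reasoning

eval-lift : ∀ (w : Word n) → eval (map Fin.suc w) ≈ lift₀ (eval w)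
eval-lift []      Fin.zero    = refl
eval-lift []      (Fin.suc x) = refl
eval-lift (i ∷ w) x = begin
  s (Fin.suc i) ⟨$⟩ʳ (eval (map Fin.suc w) ⟨$⟩ʳ x)   ≡⟨ cong (s (Fin.suc i) ⟨$⟩ʳ_) (eval-lift w x) ⟩
  s (Fin.suc i) ⟨$⟩ʳ (lift₀ (eval w) ⟨$⟩ʳ x)         ≡⟨ lift₀-transpose (inject₁ i) (Fin.suc i) _ ⟩
  lift₀ (s i) ⟨$⟩ʳ (lift₀ (eval w) ⟨$⟩ʳ x)           ≡⟨ lift₀-comp (eval w) (s i) x ⟩
  lift₀ (eval w ∘ₚ s i) ⟨$⟩ʳ x                       ∎
  where open ≡-Reasoning

to-zero : ∀ (x : Fin (suc n)) → ∃[ w ] eval w ⟨$⟩ʳ x ≡ Fin.zero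
to-zero = <-weakInduction _ ([] , refl) λ i (w , eq) →
  w ++ [ i ] , trans (eval-++ w [ i ] (Fin.suc i)) (trans (cong (eval w ⟨$⟩ʳ_) (transpose-to (inject₁ i) (Fin.suc i))) eq)

-- Once a word `v` has brought the image of `0` back to `0`, what remains is lifted from a smaller
-- symmetric group. The resulting word bounds the length of all reduced words and so makes the
-- search for them finite.
generates : ∀ n (π : Permutation′ (suc n)) → ∃[ w ] eval w ≈ π
generates zero    π = [] , λ x → trans (only x) (sym (only (π ⟨$⟩ʳ x)))
  where
  only : ∀ (x : Fin 1) → x ≡ Fin.zero
  only Fin.zero = refl
generates (suc n) π with to-zero (π ⟨$⟩ʳ Fin.zero)
... | v , v-zero with generates n (remove Fin.zero (π ∘ₚ eval v))
...   | w , w≈ = reverse v ++ map Fin.suc w , λ x → begin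
  eval (reverse v ++ map Fin.suc w) ⟨$⟩ʳ x
    ≡⟨ eval-++ (reverse v) (map Fin.suc w) x ⟩
  eval (reverse v) ⟨$⟩ʳ (eval (map Fin.suc w) ⟨$⟩ʳ x)
    ≡⟨ cong (eval (reverse v) ⟨$⟩ʳ_) (trans (eval-lift w x)
         (trans (lift₀-cong _ _ w≈ x) (lift₀-remove (π ∘ₚ eval v) v-zero x))) ⟩
  eval (reverse v) ⟨$⟩ʳ (eval v ⟨$⟩ʳ (π ⟨$⟩ʳ x))
    ≡⟨ eval-reverse v (π ⟨$⟩ʳ x) ⟩
  π ⟨$⟩ʳ x
    ∎
  where open ≡-Reasoning

wordsUpTo : ℕ → List (Word n)
wordsUpTo zero    = [ [] ]
wordsUpTo (suc k) = [] ∷ cartesianProductWith _∷_ (allFin _) (wordsUpTo k)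

∈-wordsUpTo : ∀ k (w : Word n) → length w ≤ k → w ∈ wordsUpTo k
∈-wordsUpTo zero    []      _         = here refl
∈-wordsUpTo (suc k) []      _         = here refl
∈-wordsUpTo (suc k) (i ∷ w) (s≤s len) = there (∈-cartesianProductWith⁺ _∷_ (∈-allFin i) (∈-wordsUpTo k w len))

_≈?_ : (π ρ : Permutation′ n) → Dec (π ≈ ρ)
π ≈? ρ = Fin.all? λ x → (π ⟨$⟩ʳ x) Fin.≟ (ρ ⟨$⟩ʳ x)

-- Words longer than `w` cannot refute its minimality, so finitely many tests suffice.
R? : ∀ (σ : Permutation′ (suc n)) w → Dec (R σ w)
R? σ w = (eval w ≈? σ) ×-dec map′ extend restrict
  (All.all? (λ v → (eval v ≈? σ) →-dec (length w ≤? length v)) (wordsUpTo (length w)))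
  where
  extend : All (λ v → eval v ≈ σ → length w ≤ length v) (wordsUpTo (length w)) → ∀ v → eval v ≈ σ → length w ≤ length v
  extend ps v v≈σ with length v ≤? length w
  ... | yes v≤w = All.lookup ps (∈-wordsUpTo (length w) v v≤w) v≈σ
  ... | no  v≰w = <⇒≤ (≰⇒> v≰w)
  restrict : (∀ v → eval v ≈ σ → length w ≤ length v) → All (λ v → eval v ≈ σ → length w ≤ length v) (wordsUpTo (length w))
  restrict h = All.tabulate λ {v} _ → h v

R•? : ∀ (σ : Permutation′ (suc n)) w → Dec (R• σ w)
R•? σ w = map′ (λ (r , l) → close⇒R• {σ = σ} r l) (λ r• → proj₁ r• , R•⇒close {σ = σ} r•)
  (R? σ w ×-dec Linked.linked? (λ i j → ∣ toℕ i - toℕ j ∣ ≤? 1) w)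

theoremA : ∀ (n : ℕ) → n ≥ 1 → (σ : Permutation′ (suc n)) → ∃[ k ] HasCardinality (R• σ) k × k ≤ 4
theoremA n _ σ with generates n σ
... | w₀ , w₀≈σ = length xs , (xs , unique , (λ w → mk⇔ sound complete) , refl) ,
                  atMost-4-R• σ xs unique (All.tabulate sound)
  where
  _≟ʷ_ = ≡-dec (Fin._≟_ {n})
  -- No reduced word is longer than `w₀`, so none is missed.
  candidates = filter (R•? σ) (wordsUpTo (length w₀))
  xs = deduplicate _≟ʷ_ candidates
  unique : Unique xs
  unique = DecUnique.deduplicate-! _≟ʷ_ candidates
  sound : ∀ {w} → w ∈ xs → R• σ w
  sound w∈ = proj₂ (∈-filter⁻ (R•? σ) {xs = wordsUpTo (length w₀)} (∈-deduplicate⁻ _≟ʷ_ candidates w∈))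
  complete : ∀ {w} → R• σ w → w ∈ xs
  complete {w} r•@((_ , min) , _) =
    ∈-deduplicate⁺ _≟ʷ_ (∈-filter⁺ (R•? σ) (∈-wordsUpTo (length w₀) w (min w₀ w₀≈σ)) r•)
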